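{- Let $d \ge 2$. There is an algorithm that, given a set of $n$ points in the unit hypercube $[0,1]^d$, computes in $O(n + d\log d)$ time an empty box of volume at least $$\frac{\log d}{4(n+\log d)}.$$
   Context: A box in $\mathbb{R}^d$ is an open axis-parallel hyperrectangle $(a_1,b_1)\times\cdots\times(a_d,b_d)$ with $a_i<b_i$ for $1\le i\le d$. Given a set $S$ of $n$ points in $[0,1]^d$, an empty box is a box contained in $[0,1]^d$ that contains no point of $S$. Here $\log$ denotes the logarithm in base $2$. Running time is counted in the usual random-access model of computational geometry: any coordinate of any input point can be accessed in constant time, and arithmetic operations, comparisons and the integer floor function on reals take constant time. The constant in the $O$-notation is absolute. -}

module Defs where

open import Algebra.Bundles using (CommutativeRing; Semiring)
open import Algebra.Core using (Op₁; Op₂)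
import Algebra.Definitions.RawSemiring as RawSemiringDefinitions
open import Algebra.Structures using (IsCommutativeRing)
open import Data.Bool.Base using (Bool; true; false; _∧_; if_then_else_)
open import Data.Fin.Base using (Fin; toℕ; fromℕ<)
open import Data.Integer.Base using (ℤ; +_; -[1+_])
open import Data.Nat.Base as ℕ using (ℕ; suc)
import Data.Nat.Properties as ℕₚ
open import Data.Product.Base using (∃-syntax; Σ-syntax; _×_)
open import Data.Vec.Functional using (Vector)
open import Function.Definitions using (Injective)
open import Level using (0ℓ)
open import Relation.Binary.Core using (Rel)
import Relation.Binary.Construct.StrictToNonStrict as StrictToNonStrict
open import Relation.Binary.PropositionalEquality using (_≡_; _≢_; _≗_)
open import Relation.Binary.Structures using (IsStrictTotalOrder)
open import Relation.Nullary.Decidable using (does; yes; no)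
open import Relation.Nullary.Negation using (¬_)

-- Nothing is assumed about 0# ⁻¹.
record OrderedField : Set₁ where
  infix  8 _⁻¹
  infix  8 -_
  infixl 7 _*_ _/_
  infixl 6 _+_ _-_
  infix  4 _<_

  field
    ℝ     : Set
    _+_   : Op₂ ℝ
    _*_   : Op₂ ℝ
    -_    : Op₁ ℝ
    _⁻¹   : Op₁ ℝ
    0# 1# : ℝ
    _<_   : Rel ℝ 0ℓ

    isCommutativeRing  : IsCommutativeRing _≡_ _+_ _*_ -_ 0# 1#
    isStrictTotalOrder : IsStrictTotalOrder _≡_ _<_
    0<1                : 0# < 1#
    ⁻¹-inverse         : ∀ x → x ≢ 0# → x * x ⁻¹ ≡ 1#
    +-monoˡ-<          : ∀ x {y z} → y < z → y + x < z + x
    *-pos              : ∀ {x y} → 0# < x → 0# < y → 0# < x * y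

  commutativeRing : CommutativeRing 0ℓ 0ℓ
  commutativeRing = record { isCommutativeRing = isCommutativeRing }

  open StrictToNonStrict _≡_ _<_ using (_≤_) public
  open RawSemiringDefinitions (Semiring.rawSemiring (CommutativeRing.semiring commutativeRing))
    using (product) renaming (_×_ to _·_) public
  open IsStrictTotalOrder isStrictTotalOrder using (_<?_) public

  fromℕ : ℕ → ℝ
  fromℕ n = n · 1#

  fromℤ : ℤ → ℝ
  fromℤ (+ n)    = fromℕ n
  fromℤ -[1+ n ] = - fromℕ (suc n)

  _-_ : Op₂ ℝ
  x - y = x + - y

  _/_ : Op₂ ℝ
  x / y = x * y ⁻¹

-- The real numbers, axiomatised as a Dedekind-complete ordered field; any two
-- models are classically isomorphic.  Nothing is assumed about the supremum of
-- an empty or unbounded set.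
record Reals : Set₁ where
  field
    orderedField : OrderedField

  open OrderedField orderedField public

  UpperBound : (ℝ → Set) → ℝ → Set
  UpperBound P b = ∀ {x} → P x → x ≤ b

  field
    sup       : (ℝ → Set) → ℝ
    sup-upper : ∀ P {b} → UpperBound P b → UpperBound P (sup P)
    sup-least : ∀ P {x b} → P x → UpperBound P b → sup P ≤ b

    ⌊_⌋       : ℝ → ℤ
    ⌊⌋-lower  : ∀ x → fromℤ ⌊ x ⌋ ≤ x
    ⌊⌋-upper  : ∀ x → x < fromℤ ⌊ x ⌋ + 1#

  -- p / q ≤ log₂ d iff 2 ^ p ≤ d ^ q, so for d ≥ 1 the logarithm is the
  -- supremum of the non-negative rationals below it (for d = 0 it is junk).
  log₂ : ℕ → ℝ
  log₂ d = sup λ x → ∃[ p ] ∃[ q ]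
    2 ℕ.^ p ℕ.≤ d ℕ.^ suc q × x ≡ fromℕ p / fromℕ (suc q)

module Geometry (R : Reals) where
  open Reals R

  Point : ℕ → Set
  Point d = Vector ℝ d

  InUnitCube : ∀ {d} → Point d → Set
  InUnitCube x = ∀ i → 0# ≤ x i × x i ≤ 1#

  record Box (d : ℕ) : Set where
    field
      lo hi : Point d
      lo<hi : ∀ i → lo i < hi i

  open Box public

  infix 4 _∈_
  _∈_ : ∀ {d} → Point d → Box d → Set
  x ∈ B = ∀ i → lo B i < x i × x i < hi B i

  volume : ∀ {d} → Box d → ℝ
  volume B = product λ i → hi B i - lo B i

  -- A set of n points is presented as an injective enumeration.
  record IsPointSet {n d} (S : Fin n → Point d) : Set where
    field
      distinct : Injective _≡_ _≗_ S
      inCube   : ∀ i → InUnitCube (S i)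

  record IsEmptyBox {n d} (S : Fin n → Point d) (B : Box d) : Set where
    field
      inCube : ∀ x → x ∈ B → InUnitCube x
      empty  : ∀ i → ¬ S i ∈ B

-- Programs of a real RAM.  Memory consists of arrays, named by literals, with
-- cells that hold either a natural number (counters and addresses) or a real
-- number; the array name is fixed in the program text, while the index is
-- computed.  A program is a finite text that does not depend on the input.

data Sort : Set where
  nat real : Sort

infix  8 _⟦_⟧
infixl 7 _⊗_ _⊛_ _⊘_
infixl 6 _⊕_ _∸_ _⊞_ _⊟_

data Expr : Sort → Set where
  _⟦_⟧    : ∀ {s} → ℕ → Expr nat → Expr s
  lit     : ℕ → Expr nat
  #points : Expr nat
  #dim    : Expr nat
  _⊕_     : Expr nat → Expr nat → Expr nat
  _∸_     : Expr nat → Expr nat → Expr nat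
  _⊗_     : Expr nat → Expr nat → Expr nat
  floor   : Expr real → Expr nat
  coord   : Expr nat → Expr nat → Expr real
  cast    : Expr nat → Expr real
  _⊞_     : Expr real → Expr real → Expr real
  _⊟_     : Expr real → Expr real → Expr real
  _⊛_     : Expr real → Expr real → Expr real
  _⊘_     : Expr real → Expr real → Expr real

infix 5 _≺_

data Test : Set where
  _≺_ : ∀ {s} → Expr s → Expr s → Test

infix  3 _⟦_⟧≔_
infixr 2 _⨾_

data Program : Set where
  skip   : Program
  _⟦_⟧≔_ : ∀ {s} → ℕ → Expr nat → Expr s → Program
  _⨾_    : Program → Program → Program
  cond   : Test → Program → Program → Program
  while  : Test → Program → Program

-- One time unit for each literal, memory or input access and operation.
cost : ∀ {s} → Expr s → ℕ
cost (a ⟦ e ⟧)   = 1 ℕ.+ cost e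
cost (lit k)     = 1
cost #points     = 1
cost #dim        = 1
cost (e ⊕ f)     = 1 ℕ.+ cost e ℕ.+ cost f
cost (e ∸ f)     = 1 ℕ.+ cost e ℕ.+ cost f
cost (e ⊗ f)     = 1 ℕ.+ cost e ℕ.+ cost f
cost (floor e)   = 1 ℕ.+ cost e
cost (coord e f) = 1 ℕ.+ cost e ℕ.+ cost f
cost (cast e)    = 1 ℕ.+ cost e
cost (e ⊞ f)     = 1 ℕ.+ cost e ℕ.+ cost f
cost (e ⊟ f)     = 1 ℕ.+ cost e ℕ.+ cost f
cost (e ⊛ f)     = 1 ℕ.+ cost e ℕ.+ cost f
cost (e ⊘ f)     = 1 ℕ.+ cost e ℕ.+ cost f

costTest : Test → ℕ
costTest (e ≺ f) = 1 ℕ.+ cost e ℕ.+ cost f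

module Execution (R : Reals) {n d : ℕ} (S : Fin n → Geometry.Point R d) where
  open Reals R
  open Geometry R

  Value : Sort → Set
  Value nat  = ℕ
  Value real = ℝ

  Store : Set
  Store = ∀ s → ℕ → ℕ → Value s

  initial : Store
  initial nat  _ _ = 0
  initial real _ _ = 0#

  set : {A : Set} → (ℕ → ℕ → A) → ℕ → ℕ → A → ℕ → ℕ → A
  set m a i v b j = if does (a ℕₚ.≟ b) ∧ does (i ℕₚ.≟ j) then v else m b j

  update : ∀ s → Store → ℕ → ℕ → Value s → Store
  update nat  σ a i v nat  = set (σ nat) a i v
  update nat  σ a i v real = σ real
  update real σ a i v nat  = σ nat
  update real σ a i v real = set (σ real) a i v

  -- Negative integer parts are truncated to 0.
  clamp : ℤ → ℕ
  clamp (+ k)    = k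
  clamp -[1+ _ ] = 0

  -- Reading outside the input yields 0#.
  input : ℕ → ℕ → ℝ
  input p i with p ℕₚ.<? n | i ℕₚ.<? d
  ... | yes p<n | yes i<d = S (fromℕ< p<n) (fromℕ< i<d)
  ... | _       | _       = 0#

  eval : ∀ {s} → Store → Expr s → Value s
  eval {s} σ (a ⟦ e ⟧) = σ s a (eval σ e)
  eval σ (lit k)       = k
  eval σ #points       = n
  eval σ #dim          = d
  eval σ (e ⊕ f)       = eval σ e ℕ.+ eval σ f
  eval σ (e ∸ f)       = eval σ e ℕ.∸ eval σ f
  eval σ (e ⊗ f)       = eval σ e ℕ.* eval σ f
  eval σ (floor e)     = clamp ⌊ eval σ e ⌋
  eval σ (coord e f)   = input (eval σ e) (eval σ f)
  eval σ (cast e)      = fromℕ (eval σ e)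
  eval σ (e ⊞ f)       = eval σ e + eval σ f
  eval σ (e ⊟ f)       = eval σ e - eval σ f
  eval σ (e ⊛ f)       = eval σ e * eval σ f
  eval σ (e ⊘ f)       = eval σ e / eval σ f

  test : Store → Test → Bool
  test σ (_≺_ {nat}  e f) = does (eval σ e ℕₚ.<? eval σ f)
  test σ (_≺_ {real} e f) = does (eval σ e <? eval σ f)

  infix 3 ⟨_,_⟩⇓[_]_

  -- ⟨ c , σ ⟩⇓[ t ] σ′: started in σ, the program c halts in σ′ after t steps.
  data ⟨_,_⟩⇓[_]_ : Program → Store → ℕ → Store → Set where
    ⇓-skip   : ∀ {σ} → ⟨ skip , σ ⟩⇓[ 1 ] σ
    ⇓-assign : ∀ {s a i σ} {e : Expr s} →
               ⟨ a ⟦ i ⟧≔ e , σ ⟩⇓[ 1 ℕ.+ cost i ℕ.+ cost e ]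
                 update s σ a (eval σ i) (eval σ e)
    ⇓-seq    : ∀ {c₁ c₂ σ₀ σ₁ σ₂ t₁ t₂} →
               ⟨ c₁ , σ₀ ⟩⇓[ t₁ ] σ₁ → ⟨ c₂ , σ₁ ⟩⇓[ t₂ ] σ₂ →
               ⟨ c₁ ⨾ c₂ , σ₀ ⟩⇓[ t₁ ℕ.+ t₂ ] σ₂
    ⇓-then   : ∀ {b c₁ c₂ σ σ′ t} → test σ b ≡ true → ⟨ c₁ , σ ⟩⇓[ t ] σ′ →
               ⟨ cond b c₁ c₂ , σ ⟩⇓[ costTest b ℕ.+ t ] σ′
    ⇓-else   : ∀ {b c₁ c₂ σ σ′ t} → test σ b ≡ false → ⟨ c₂ , σ ⟩⇓[ t ] σ′ →
               ⟨ cond b c₁ c₂ , σ ⟩⇓[ costTest b ℕ.+ t ] σ′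
    ⇓-exit   : ∀ {b c σ} → test σ b ≡ false →
               ⟨ while b c , σ ⟩⇓[ costTest b ] σ
    ⇓-loop   : ∀ {b c σ₀ σ₁ σ₂ t₁ t₂} → test σ₀ b ≡ true →
               ⟨ c , σ₀ ⟩⇓[ t₁ ] σ₁ → ⟨ while b c , σ₁ ⟩⇓[ t₂ ] σ₂ →
               ⟨ while b c , σ₀ ⟩⇓[ costTest b ℕ.+ t₁ ℕ.+ t₂ ] σ₂

  -- The output box is left in the real arrays 0 and 1.
  Output : Store → Box d → Set
  Output σ B = ∀ i → σ real 0 (toℕ i) ≡ lo B i × σ real 1 (toℕ i) ≡ hi B i

  -- Started with cleared memory on the input S, c halts after t steps with
  -- output B.
  Computes : Program → Box d → ℕ → Set
  Computes c B t = Σ[ σ ∈ Store ] ⟨ c , initial ⟩⇓[ t ] σ × Output σ B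

module Bounds (R : Reals) where
  open Reals R
  open Geometry R

  TimeAtMost : (C n d t : ℕ) → Set
  TimeAtMost C n d t = fromℕ t ≤ fromℕ C * (fromℕ n + fromℕ d * log₂ d)

  VolumeAtLeast : ∀ {d} → ℕ → Box d → Set
  VolumeAtLeast {d} n B =
    log₂ d / (fromℕ 4 * (fromℕ n + log₂ d)) ≤ volume B

{-# OPTIONS --safe #-}
module Submission where

-- Let k = ⌊log d⌋ and m = ⌊n / (k + 1)⌋ + 1.  Of the m slabs of width 1/m
-- orthogonal to axis 0, one contains at most k points in its interior.  Record
-- for each axis on which side of the middle of the slab these points lie; this
-- gives d codes below 2 ^ k ≤ d.  Together with the code 0 of an additional
-- virtual axis d, two of them coincide by the pigeonhole principle.  If the axes
-- j < i have the same code, then the upper half of the slab along j, intersected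
-- with its lower half along i, is empty and has volume at least 1/(4m).
-- A table indexed by codes finds the collision in O(d) steps.

open import Defs
open import Algebra.Bundles using (CommutativeRing)
import Algebra.Properties.Ring as RingProperties
import Algebra.Properties.Semiring.Mult as SemiringMult
import Algebra.Solver.Ring.NaturalCoefficients.Default as SemiringSolver
open import Data.Bool.Base as Bool using (Bool; true; false; if_then_else_; _∧_; _∨_)
open import Data.Fin.Base using (Fin; zero; suc; toℕ; fromℕ<)
import Data.Fin.Properties as Finₚ
import Data.Integer.Base as ℤ
open import Data.Nat.Base as ℕ using (ℕ; zero; suc)
import Data.Nat.Properties as ℕₚ
open import Data.Nat.Solver using (module +-*-Solver)
open import Data.Product.Base using (Σ-syntax; ∃-syntax; _×_; _,_; proj₁; proj₂)
open import Data.Sum.Base using (inj₁; inj₂)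
open import Function.Base using (_∘_)
open import Relation.Binary.Bundles using (StrictTotalOrder)
open import Relation.Binary.Definitions using (tri<; tri≈; tri>)
open import Relation.Binary.PropositionalEquality
open import Relation.Nullary.Decidable using (Dec; does; yes; no; dec-true; dec-false; _because_)
open import Relation.Nullary.Negation using (¬_; contradiction)
open import Relation.Nullary.Reflects using (invert)

-- The virtual axis is needed because 2 ^ k may equal d, and then the d codes can all be distinct.
-- Every point reads as 0 there, below the middle, so a collision of axis j with it means that no
-- point in the slab lies above the middle along j; the box then loses only one half. The number m
-- of slabs balances two demands. Being more than n / (k + 1), it forces a slab with at most k
-- points; being at most n / (k + 1) + 1, it turns log d ≤ k + 1 into m log d ≤ n + log d, which is
-- the volume bound, the factor 4 coming from the two halvings. The time bound rests on dismissing
-- the points outside the chosen slab in constant time: only its at most k points are compared with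
-- the middle along all axes. A code records only whether a point is strictly above the middle; a
-- point on a middle hyperplane avoids the open box anyway.

-- Arithmetic in ordered fields

module OrderedFieldProperties (F : OrderedField) where
  open OrderedField F
  open CommutativeRing commutativeRing public
    using ( ring; semiring; commutativeSemiring; +-assoc; +-comm
          ; *-assoc; *-comm; +-identityˡ; +-identityʳ; *-identityˡ; *-identityʳ
          ; zeroʳ; zeroˡ; distribʳ; -‿inverseʳ; -‿inverseˡ)
  open SemiringSolver commutativeSemiring using (solve; _:=_; _:+_; _:*_; con)

  strictTotalOrder : StrictTotalOrder _ _ _
  strictTotalOrder = record { isStrictTotalOrder = isStrictTotalOrder }

  open StrictTotalOrder strictTotalOrder public
    using (compare; strictPartialOrder)
    renaming (trans to <-trans; irrefl to <-irrefl; asym to <-asym)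
  module ≤-Reasoning where
    open import Relation.Binary.Reasoning.StrictPartialOrder strictPartialOrder public

  open ≤-Reasoning

  ≤-refl : ∀ {x} → x ≤ x
  ≤-refl = inj₂ refl

  ≤-trans : ∀ {x y z} → x ≤ y → y ≤ z → x ≤ z
  ≤-trans {x} {y} {z} x≤y y≤z = begin x ≤⟨ x≤y ⟩ y ≤⟨ y≤z ⟩ z ∎

  <-≤-trans : ∀ {x y z} → x < y → y ≤ z → x < z
  <-≤-trans {x} {y} {z} x<y y≤z = begin-strict x <⟨ x<y ⟩ y ≤⟨ y≤z ⟩ z ∎

  ≤-<-trans : ∀ {x y z} → x ≤ y → y < z → x < z
  ≤-<-trans {x} {y} {z} x≤y y<z = begin-strict x ≤⟨ x≤y ⟩ y <⟨ y<z ⟩ z ∎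

  <⇒≱ : ∀ {x y} → x < y → ¬ y ≤ x
  <⇒≱ x<y y≤x = <-irrefl refl (<-≤-trans x<y y≤x)

  >⇒≢ : ∀ {x y} → x < y → y ≢ x
  >⇒≢ x<y y≡x = <-irrefl (sym y≡x) x<y

  +-monoʳ-< : ∀ x {y z} → y < z → x + y < x + z
  +-monoʳ-< x {y} {z} y<z = subst₂ _<_ (+-comm y x) (+-comm z x) (+-monoˡ-< x y<z)

  +-monoˡ-≤ : ∀ x {y z} → y ≤ z → y + x ≤ z + x
  +-monoˡ-≤ x (inj₁ y<z)  = inj₁ (+-monoˡ-< x y<z)
  +-monoˡ-≤ x (inj₂ refl) = ≤-refl

  +-monoʳ-≤ : ∀ x {y z} → y ≤ z → x + y ≤ x + z
  +-monoʳ-≤ x (inj₁ y<z)  = inj₁ (+-monoʳ-< x y<z)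
  +-monoʳ-≤ x (inj₂ refl) = ≤-refl

  x-y+y≡x : ∀ x y → x - y + y ≡ x
  x-y+y≡x x y = trans (+-assoc x (- y) y) (trans (cong (x +_) (-‿inverseˡ y)) (+-identityʳ x))

  x+y-y≡x : ∀ x y → x + y - y ≡ x
  x+y-y≡x x y = trans (+-assoc x y (- y)) (trans (cong (x +_) (-‿inverseʳ y)) (+-identityʳ x))

  x≡z+y⇒x-y≡z : ∀ {x y z} → x ≡ z + y → x - y ≡ z
  x≡z+y⇒x-y≡z {_} {y} {z} refl = x+y-y≡x z y

  x<y⇒0<y-x : ∀ {x y} → x < y → 0# < y - x
  x<y⇒0<y-x {x} x<y = subst (_< _) (-‿inverseʳ x) (+-monoˡ-< (- x) x<y)

  0<y-x⇒x<y : ∀ {x y} → 0# < y - x → x < y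
  0<y-x⇒x<y {x} {y} 0<y-x = subst₂ _<_ (+-identityˡ x) (x-y+y≡x y x) (+-monoˡ-< x 0<y-x)

  *-monoʳ-< : ∀ {x y z} → 0# < x → y < z → x * y < x * z
  *-monoʳ-< {x} {y} {z} 0<x y<z = 0<y-x⇒x<y
    (subst (0# <_) (RingProperties.x[y-z]≈xy-xz ring x z y) (*-pos 0<x (x<y⇒0<y-x y<z)))

  *-monoʳ-≤ : ∀ {x y z} → 0# ≤ x → y ≤ z → x * y ≤ x * z
  *-monoʳ-≤                 (inj₁ 0<x)  (inj₁ y<z)  = inj₁ (*-monoʳ-< 0<x y<z)
  *-monoʳ-≤ {y = y} {z = z} (inj₂ refl) (inj₁ y<z)  = inj₂ (trans (zeroˡ y) (sym (zeroˡ z)))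
  *-monoʳ-≤                 _           (inj₂ refl) = ≤-refl

  *-monoˡ-≤ : ∀ {x y z} → 0# ≤ x → y ≤ z → y * x ≤ z * x
  *-monoˡ-≤ 0≤x y≤z = subst₂ _≤_ (*-comm _ _) (*-comm _ _) (*-monoʳ-≤ 0≤x y≤z)

  0<x⇒0<x⁻¹ : ∀ {x} → 0# < x → 0# < x ⁻¹
  0<x⇒0<x⁻¹ {x} 0<x with compare 0# (x ⁻¹)
  ... | tri< 0<x⁻¹ _ _ = 0<x⁻¹
  ... | tri≈ _ 0≡x⁻¹ _ = contradiction
          (trans (sym (⁻¹-inverse x (>⇒≢ 0<x))) (trans (cong (x *_) (sym 0≡x⁻¹)) (zeroʳ x)))
          (>⇒≢ 0<1)
  ... | tri> _ _ x⁻¹<0 = contradiction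
          (subst₂ _<_ (⁻¹-inverse x (>⇒≢ 0<x)) (zeroʳ x) (*-monoʳ-< 0<x x⁻¹<0))
          (<-asym 0<1)

  x*[y/x]≡y : ∀ {x} → 0# < x → ∀ y → x * (y / x) ≡ y
  x*[y/x]≡y {x} 0<x y = begin-equality
    x * (y * x ⁻¹)   ≡⟨ solve 3 (λ x y z → x :* (y :* z) := y :* (x :* z)) refl x y (x ⁻¹) ⟩
    y * (x * x ⁻¹)   ≡⟨ cong (y *_) (⁻¹-inverse x (>⇒≢ 0<x)) ⟩
    y * 1#           ≡⟨ *-identityʳ y ⟩
    y                ∎

  y/x<z⇒y<x*z : ∀ {x y z} → 0# < x → y / x < z → y < x * z
  y/x<z⇒y<x*z {y = y} 0<x y/x<z = subst (_< _) (x*[y/x]≡y 0<x y) (*-monoʳ-< 0<x y/x<z)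

  z<y/x⇒x*z<y : ∀ {x y z} → 0# < x → z < y / x → x * z < y
  z<y/x⇒x*z<y {y = y} 0<x z<y/x = subst (_ <_) (x*[y/x]≡y 0<x y) (*-monoʳ-< 0<x z<y/x)

  y≤x*z⇒y/x≤z : ∀ {x y z} → 0# < x → y ≤ x * z → y / x ≤ z
  y≤x*z⇒y/x≤z {x} {y} {z} 0<x y≤x*z = begin
    y * x ⁻¹       ≤⟨ *-monoˡ-≤ (inj₁ (0<x⇒0<x⁻¹ 0<x)) y≤x*z ⟩
    x * z * x ⁻¹   ≡⟨ *-assoc x z (x ⁻¹) ⟩
    x * (z / x)    ≡⟨ x*[y/x]≡y 0<x z ⟩
    z              ∎

  fromℕ-+ : ∀ m n → fromℕ (m ℕ.+ n) ≡ fromℕ m + fromℕ n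
  fromℕ-+ = SemiringMult.×-homo-+ semiring 1#

  fromℕ-* : ∀ m n → fromℕ (m ℕ.* n) ≡ fromℕ m * fromℕ n
  fromℕ-* = SemiringMult.×1-homo-* semiring

  0≤fromℕ : ∀ n → 0# ≤ fromℕ n
  0<fromℕ : ∀ n → 0# < fromℕ (suc n)
  0≤fromℕ zero    = ≤-refl
  0≤fromℕ (suc n) = inj₁ (0<fromℕ n)
  0<fromℕ n = <-≤-trans 0<1 (subst (_≤ fromℕ (suc n)) (+-identityʳ 1#) (+-monoʳ-≤ 1# (0≤fromℕ n)))

  fromℕ-mono-≤ : ∀ {m n} → m ℕ.≤ n → fromℕ m ≤ fromℕ n
  fromℕ-mono-≤ {n = n} ℕ.z≤n = 0≤fromℕ n
  fromℕ-mono-≤ (ℕ.s≤s m≤n)   = +-monoʳ-≤ 1# (fromℕ-mono-≤ m≤n)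

  fromℕ-cancel-< : ∀ {m n} → fromℕ m < fromℕ n → m ℕ.< n
  fromℕ-cancel-< m<n = ℕₚ.≰⇒> λ n≤m → <⇒≱ m<n (fromℕ-mono-≤ n≤m)

  ½ : ℝ
  ½ = fromℕ 2 ⁻¹

  0<½ : 0# < ½
  0<½ = 0<x⇒0<x⁻¹ (0<fromℕ 1)

  ½+½≡1 : ½ + ½ ≡ 1#
  ½+½≡1 = trans (solve 1 (λ x → x :+ x := (con 1 :+ (con 1 :+ con 0)) :* x) refl ½) (⁻¹-inverse (fromℕ 2) (>⇒≢ (0<fromℕ 1)))

  midpoint : ℝ → ℝ → ℝ
  midpoint x y = (x + y) / fromℕ 2

  module _ (x y : ℝ) where
    private
      w : ℝ
      w = y - x

      -- Writing y as w + x eliminates subtraction, which the semiring solver cannot handle.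
      w+x≡y : w + x ≡ y
      w+x≡y = x-y+y≡x y x

    midpoint-x : midpoint x y - x ≡ ½ * w
    midpoint-x = x≡z+y⇒x-y≡z (begin-equality
      (x + y) * ½             ≡⟨ cong (λ z → (x + z) * ½) w+x≡y ⟨
      (x + (w + x)) * ½       ≡⟨ solve 3 (λ x w h → (x :+ (w :+ x)) :* h := h :* w :+ x :* (h :+ h)) refl x w ½ ⟩
      ½ * w + x * (½ + ½)     ≡⟨ cong (λ z → ½ * w + x * z) ½+½≡1 ⟩
      ½ * w + x * 1#          ≡⟨ cong (½ * w +_) (*-identityʳ x) ⟩
      ½ * w + x               ∎)

    y-midpoint : y - midpoint x y ≡ ½ * w
    y-midpoint = x≡z+y⇒x-y≡z (begin-equality
      y                          ≡⟨ w+x≡y ⟨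
      w + x                      ≡⟨ *-identityʳ _ ⟨
      (w + x) * 1#               ≡⟨ cong ((w + x) *_) ½+½≡1 ⟨
      (w + x) * (½ + ½)          ≡⟨ solve 3 (λ x w h → (w :+ x) :* (h :+ h) := h :* w :+ (x :+ (w :+ x)) :* h) refl x w ½ ⟩
      ½ * w + (x + (w + x)) * ½  ≡⟨ cong (λ z → ½ * w + (x + z) * ½) w+x≡y ⟩
      ½ * w + (x + y) * ½        ∎)

  x<midpoint : ∀ {x y} → x < y → x < midpoint x y
  x<midpoint {x} {y} x<y = 0<y-x⇒x<y
    (subst (0# <_) (sym (midpoint-x x y)) (*-pos 0<½ (x<y⇒0<y-x x<y)))

  midpoint<y : ∀ {x y} → x < y → midpoint x y < y
  midpoint<y {x} {y} x<y = 0<y-x⇒x<y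
    (subst (0# <_) (sym (y-midpoint x y)) (*-pos 0<½ (x<y⇒0<y-x x<y)))

  product-cong : ∀ {n} {f g : Fin n → ℝ} → f ≗ g → product f ≡ product g
  product-cong {zero}  f≗g = refl
  product-cong {suc n} f≗g = cong₂ _*_ (f≗g zero) (product-cong (f≗g ∘ suc))

  product-pos : ∀ {n} {f : Fin n → ℝ} → (∀ i → 0# < f i) → 0# < product f
  product-pos {zero}  0<f = 0<1
  product-pos {suc n} 0<f = *-pos (0<f zero) (product-pos (0<f ∘ suc))

  product-1 : ∀ {n} {f : Fin n → ℝ} → (∀ i → f i ≡ 1#) → product f ≡ 1#
  product-1 {zero}  f≡1 = refl
  product-1 {suc n} f≡1 = trans (cong₂ _*_ (f≡1 zero) (product-1 (f≡1 ∘ suc))) (*-identityʳ 1#)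

  -- Cutting a box along one axis changes a single factor of its volume; `volume-≥` applies this to
  -- each halved axis that is not virtual.
  product-scale : ∀ {n} {f g : Fin n → ℝ} j c → f j ≡ c * g j → (∀ i → i ≢ j → f i ≡ g i) →
                  product f ≡ c * product g
  product-scale {suc n} {f} {g} zero c fj≡c*gj f≗g = begin-equality
    f zero * product (f ∘ suc)         ≡⟨ cong₂ _*_ fj≡c*gj (product-cong λ i → f≗g (suc i) λ ()) ⟩
    c * g zero * product (g ∘ suc)     ≡⟨ *-assoc c _ _ ⟩
    c * (g zero * product (g ∘ suc))   ∎
  product-scale {suc n} {f} {g} (suc j) c fj≡c*gj f≗g = begin-equality
    f zero * product (f ∘ suc)         ≡⟨ cong₂ _*_ (f≗g zero λ ()) (product-scale j c fj≡c*gj λ i i≢j → f≗g (suc i) λ { refl → i≢j refl }) ⟩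
    g zero * (c * product (g ∘ suc))   ≡⟨ solve 3 (λ a c p → a :* (c :* p) := c :* (a :* p)) refl (g zero) c _ ⟩
    c * (g zero * product (g ∘ suc))   ∎

-- Bounds on the logarithm and the floor

module RealsProperties (R : Reals) where
  open Reals R
  open OrderedFieldProperties orderedField
  open ≤-Reasoning

  -- Otherwise k(q + 1) ≤ p, and d ^ (q + 1) < 2 ^ (k(q + 1)) ≤ 2 ^ p ≤ d ^ (q + 1). Both estimates
  -- of `log₂` depend on this, because the axioms are silent about the supremum of an unbounded set.
  log₂-upper : ∀ d k → d ℕ.< 2 ℕ.^ k → UpperBound (λ x → ∃[ p ] ∃[ q ]
    2 ℕ.^ p ℕ.≤ d ℕ.^ suc q × x ≡ fromℕ p / fromℕ (suc q)) (fromℕ k)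
  log₂-upper d k d<2^k (p , q , 2^p≤d^q , refl) = y≤x*z⇒y/x≤z (0<fromℕ q)
    (subst (fromℕ p ≤_) (trans (cong fromℕ (ℕₚ.*-comm k (suc q))) (fromℕ-* (suc q) k))
      (fromℕ-mono-≤ (ℕₚ.<⇒≤ p<k*q)))
    where
    p<k*q : p ℕ.< k ℕ.* suc q
    p<k*q = ℕₚ.≰⇒> λ k*q≤p → ℕₚ.<-irrefl refl (ℕₚ.<-≤-trans
      (ℕₚ.<-≤-trans (ℕₚ.^-monoˡ-< (suc q) d<2^k)
        (ℕₚ.≤-trans (ℕₚ.≤-reflexive (ℕₚ.^-*-assoc 2 k (suc q))) (ℕₚ.^-monoʳ-≤ 2 k*q≤p)))
      2^p≤d^q)

  log₂-≤ : ∀ d k → 1 ℕ.≤ d → d ℕ.< 2 ℕ.^ k → log₂ d ≤ fromℕ k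
  log₂-≤ d k 1≤d d<2^k = sup-least _
    -- `sup-least` asks for a member of the set; the rational 0 / 1 is one as d ≥ 1.
    (0 , 0 , subst (1 ℕ.≤_) (sym (ℕₚ.*-identityʳ d)) 1≤d , refl) (log₂-upper d k d<2^k)

  log₂-≥ : ∀ d k K → 2 ℕ.^ k ℕ.≤ d → d ℕ.< 2 ℕ.^ K → fromℕ k ≤ log₂ d
  log₂-≥ d k K 2^k≤d d<2^K = sup-upper _ (log₂-upper d K d<2^K)
    (k , 0 , subst (2 ℕ.^ k ℕ.≤_) (sym (ℕₚ.*-identityʳ d)) 2^k≤d , sym k/1≡k)
    where
    k/1≡k : fromℕ k / fromℕ 1 ≡ fromℕ k
    k/1≡k = begin-equality
      fromℕ k / fromℕ 1             ≡⟨ *-identityˡ _ ⟨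
      1# * (fromℕ k / fromℕ 1)      ≡⟨ cong (_* (fromℕ k / fromℕ 1)) (+-identityʳ 1#) ⟨
      fromℕ 1 * (fromℕ k / fromℕ 1) ≡⟨ x*[y/x]≡y (0<fromℕ 0) (fromℕ k) ⟩
      fromℕ k                       ∎

  -- Since `fromℕ` reflects the strict order, a floor q ≥ 0 satisfies q < k + 1 and k < q + 1. A
  -- negative floor would give x < 0.
  floor-unique : ∀ {x k} → fromℕ k < x → x < fromℕ (suc k) → ⌊ x ⌋ ≡ ℤ.+ k
  floor-unique {x} {k} k<x x<1+k with ⌊ x ⌋ | ⌊⌋-lower x | ⌊⌋-upper x
  ... | ℤ.+ q       | q≤x | x<q+1 = cong ℤ.+_ (ℕₚ.≤-antisym
          (ℕ.s≤s⁻¹ (fromℕ-cancel-< {q} {suc k} (≤-<-trans q≤x x<1+k)))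
          (ℕ.s≤s⁻¹ (fromℕ-cancel-< {k} {suc q} (<-trans k<x (subst (x <_) (+-comm _ 1#) x<q+1)))))
  ... | ℤ.-[1+ q ] | _   | x<-q = contradiction
          (<-trans (≤-<-trans (0≤fromℕ k) k<x) (<-≤-trans x<-q -q≤0)) (<-irrefl refl)
    where
    -q≤0 : - fromℕ (suc q) + 1# ≤ 0#
    -q≤0 = begin
      - fromℕ (suc q) + 1#             ≡⟨ cong (- fromℕ (suc q) +_) (+-identityʳ 1#) ⟨
      - fromℕ (suc q) + fromℕ 1        ≤⟨ +-monoʳ-≤ _ (fromℕ-mono-≤ {1} {suc q} (ℕ.s≤s ℕ.z≤n)) ⟩
      - fromℕ (suc q) + fromℕ (suc q)  ≡⟨ -‿inverseˡ _ ⟩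
      0#                               ∎

-- Counting, binary codes and the collision table

n<2^n : ∀ n → n ℕ.< 2 ℕ.^ n
n<2^n zero    = ℕ.s≤s ℕ.z≤n
n<2^n (suc n) = ℕₚ.<-≤-trans (ℕₚ.m<n+m (suc n) (ℕ.s≤s ℕ.z≤n))
  (ℕₚ.≤-trans (ℕₚ.≤-reflexive (cong (suc n ℕ.+_) (sym (ℕₚ.+-identityʳ (suc n))))) (ℕₚ.*-monoʳ-≤ 2 (n<2^n n)))

module Counting (b : ℕ → ℕ) where

  count : ℕ → ℕ → ℕ
  count v zero    = 0
  count v (suc p) = if does (b p ℕₚ.≟ v) then suc (count v p) else count v p

  count-hit : ∀ {v p} → b p ≡ v → count v (suc p) ≡ suc (count v p)
  count-hit {v} {p} bp≡v rewrite dec-true (b p ℕₚ.≟ v) bp≡v = refl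

  count-miss : ∀ {v p} → b p ≢ v → count v (suc p) ≡ count v p
  count-miss {v} {p} bp≢v rewrite dec-false (b p ℕₚ.≟ v) bp≢v = refl

  -- Stands for the sum of `count v p` over all v below m. Values from m on are left out: a point
  -- whose first coordinate is 1 falls into a bucket beyond the last slab.
  countBelow : ℕ → ℕ → ℕ
  countBelow m zero    = 0
  countBelow m (suc p) = if does (b p ℕₚ.<? m) then suc (countBelow m p) else countBelow m p

  countBelow-≤ : ∀ m p → countBelow m p ℕ.≤ p
  countBelow-≤ m zero = ℕ.z≤n
  countBelow-≤ m (suc p) with does (b p ℕₚ.<? m)
  ... | true  = ℕ.s≤s (countBelow-≤ m p)
  ... | false = ℕₚ.m≤n⇒m≤1+n (countBelow-≤ m p)

  countBelow-suc : ∀ m p → countBelow (suc m) p ≡ count m p ℕ.+ countBelow m p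
  countBelow-suc m zero = refl
  countBelow-suc m (suc p) with ℕₚ.<-cmp (b p) m
  ... | tri< b<m b≢m _
      rewrite dec-true (b p ℕₚ.<? m) b<m | dec-false (b p ℕₚ.≟ m) b≢m
            | dec-true (b p ℕₚ.<? suc m) (ℕₚ.m<n⇒m<1+n b<m)
      = trans (cong suc (countBelow-suc m p)) (sym (ℕₚ.+-suc _ _))
  ... | tri≈ b≮m b≡m _
      rewrite dec-false (b p ℕₚ.<? m) b≮m | dec-true (b p ℕₚ.≟ m) b≡m
            | dec-true (b p ℕₚ.<? suc m) (ℕ.s≤s (ℕₚ.≤-reflexive b≡m))
      = cong suc (countBelow-suc m p)
  ... | tri> b≮m b≢m m<b
      rewrite dec-false (b p ℕₚ.<? m) b≮m | dec-false (b p ℕₚ.≟ m) b≢m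
            | dec-false (b p ℕₚ.<? suc m) (ℕₚ.<⇒≱ (ℕ.s≤s m<b))
      = countBelow-suc m p

  -- Each index is counted for at most one value, so the counts add up to at most n.
  -- `findSlab-halts` uses the contrapositive to obtain a slab with few points.
  count-pigeonhole : ∀ {k n} m → (∀ v → v ℕ.< m → k ℕ.≤ count v n) → m ℕ.* k ℕ.≤ n
  count-pigeonhole {k} {n} m k≤count = ℕₚ.≤-trans (m*k≤countBelow m k≤count) (countBelow-≤ m n)
    where
    m*k≤countBelow : ∀ m → (∀ v → v ℕ.< m → k ℕ.≤ count v n) → m ℕ.* k ℕ.≤ countBelow m n
    m*k≤countBelow zero    _       = ℕ.z≤n
    m*k≤countBelow (suc m) k≤count rewrite countBelow-suc m n = ℕₚ.+-mono-≤
      (k≤count m ℕₚ.≤-refl) (m*k≤countBelow m λ v v<m → k≤count v (ℕₚ.m<n⇒m<1+n v<m))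

shift : Bool → ℕ → ℕ
shift false c = 2 ℕ.* c
shift true  c = suc (2 ℕ.* c)

shift-injective : ∀ {x y c c′} → shift x c ≡ shift y c′ → x ≡ y × c ≡ c′
shift-injective {false} {false} eq = refl , ℕₚ.*-cancelˡ-≡ _ _ 2 eq
shift-injective {false} {true} {c} {c′} eq = contradiction eq (ℕₚ.even≢odd c c′)
shift-injective {true} {false} {c} {c′} eq = contradiction (sym eq) (ℕₚ.even≢odd c′ c)
shift-injective {true}  {true}  eq = refl , ℕₚ.*-cancelˡ-≡ _ _ 2 (ℕₚ.suc-injective eq)

shift-< : ∀ x {c M} → c ℕ.< M → shift x c ℕ.< 2 ℕ.* M
shift-< x {c} {M} c<M = ℕₚ.≤-trans (shift≤ x) (ℕₚ.*-monoʳ-≤ 2 c<M)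
  where
  shift≤ : ∀ x → suc (shift x c) ℕ.≤ 2 ℕ.* suc c
  shift≤ false = ℕₚ.≤-trans (ℕₚ.n≤1+n _) (ℕₚ.≤-reflexive (sym (ℕₚ.*-suc 2 c)))
  shift≤ true  = ℕₚ.≤-reflexive (sym (ℕₚ.*-suc 2 c))

-- The bits β q of the indices q < p with b q ≡ s, read as a binary numeral.
module Coding (b : ℕ → ℕ) (s : ℕ) where
  open Counting b

  code : (ℕ → Bool) → ℕ → ℕ
  code β zero    = 0
  code β (suc p) = if does (b p ℕₚ.≟ s) then shift (β p) (code β p) else code β p

  code-hit : ∀ {β p} → b p ≡ s → code β (suc p) ≡ shift (β p) (code β p)
  code-hit {p = p} bp≡s rewrite dec-true (b p ℕₚ.≟ s) bp≡s = refl

  code-miss : ∀ {β p} → b p ≢ s → code β (suc p) ≡ code β p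
  code-miss {p = p} bp≢s rewrite dec-false (b p ℕₚ.≟ s) bp≢s = refl

  code-< : ∀ β p → code β p ℕ.< 2 ℕ.^ count s p
  code-< β zero = ℕ.s≤s ℕ.z≤n
  code-< β (suc p) with does (b p ℕₚ.≟ s)
  ... | true  = shift-< (β p) (code-< β p)
  ... | false = code-< β p

  -- The places of the digits depend only on `b` and `s`, so both numerals have the same length and
  -- leading zeros cause no ambiguity. Parity recovers the last digit.
  code-injective : ∀ {β γ p} → code β p ≡ code γ p → ∀ {q} → q ℕ.< p → b q ≡ s → β q ≡ γ q
  code-injective {β} {γ} {suc p} eq {q} q<1+p bq≡s with ℕₚ.<-cmp q p | b p ℕₚ.≟ s
  ... | tri< q<p _ _  | yes bp≡s rewrite dec-true (b p ℕₚ.≟ s) bp≡s =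
          code-injective {β} {γ} (proj₂ (shift-injective {β p} {γ p} eq)) q<p bq≡s
  ... | tri< q<p _ _  | no bp≢s rewrite dec-false (b p ℕₚ.≟ s) bp≢s = code-injective {β} {γ} eq q<p bq≡s
  ... | tri≈ _ refl _ | _ rewrite dec-true (b p ℕₚ.≟ s) bq≡s = proj₁ (shift-injective {β p} {γ p} eq)
  ... | tri> _ _ p<q  | _ = contradiction (ℕ.s≤s⁻¹ q<1+p) (ℕₚ.<⇒≱ p<q)

-- Indices are stored increased by one, so that 0 means that v does not occur.
module Table (f : ℕ → ℕ) where

  table : ℕ → ℕ → ℕ
  table v zero    = 0
  table v (suc x) = if does (f x ℕₚ.≟ v) then suc x else table v x

  table-sound : ∀ {v y} x → table v x ≡ suc y → y ℕ.< x × f y ≡ v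
  table-sound {v} (suc x) eq with f x ℕₚ.≟ v
  ... | yes fx≡v rewrite dec-true (f x ℕₚ.≟ v) fx≡v | ℕₚ.suc-injective eq = ℕₚ.≤-refl , fx≡v
  ... | no fx≢v rewrite dec-false (f x ℕₚ.≟ v) fx≢v
      with y<x , fy≡v ← table-sound x eq = ℕₚ.m<n⇒m<1+n y<x , fy≡v

  table-complete : ∀ {v} x → table v x ≡ 0 → ∀ {y} → y ℕ.< x → f y ≢ v
  table-complete {v} (suc x) eq {y} y<1+x fy≡v with f x ℕₚ.≟ v | ℕₚ.<-cmp y x
  ... | yes fx≡v | _              rewrite dec-true (f x ℕₚ.≟ v) fx≡v = contradiction eq λ ()
  ... | no fx≢v  | tri< y<x _ _   rewrite dec-false (f x ℕₚ.≟ v) fx≢v = table-complete x eq y<x fy≡v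
  ... | no fx≢v  | tri≈ _ refl _  = fx≢v fy≡v
  ... | no _     | tri> _ _ x<y   = ℕₚ.<⇒≱ x<y (ℕ.s≤s⁻¹ y<1+x)

  -- If each lookup at y fails, then f is injective on the d + 1 indices up to d, yet it takes only
  -- d values there.
  table-pigeonhole : ∀ {d} → (∀ y → y ℕ.≤ d → f y ℕ.< d) → ¬ (∀ y → y ℕ.≤ d → table (f y) y ≡ 0)
  table-pigeonhole {d} f<d none
    with i , j , i<j , fi≡fj ← Finₚ.pigeonhole (ℕₚ.n<1+n d) (λ i → fromℕ< (f<d (toℕ i) (Finₚ.toℕ≤pred[n] i)))
    = table-complete (toℕ j) (none (toℕ j) (Finₚ.toℕ≤pred[n] j)) i<j
        (trans (sym (Finₚ.toℕ-fromℕ< _)) (trans (cong toℕ fi≡fj) (Finₚ.toℕ-fromℕ< _)))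

-- A program logic with running times

does-true : ∀ {A : Set} (A? : Dec A) → does A? ≡ true → A
does-true (true because [a]) _ = invert [a]

does-false : ∀ {A : Set} (A? : Dec A) → does A? ≡ false → ¬ A
does-false (false because [¬a]) _ = invert [¬a]

sameSort : Sort → Sort → Bool
sameSort nat  nat  = true
sameSort real real = true
sameSort _    _    = false

-- An over-approximation by whole arrays instead of cells. It is computed from the program text
-- alone, so the premise of `frame` is `refl` for concrete programs.
writes : Program → Sort → ℕ → Bool
writes skip               s a = false
writes (_⟦_⟧≔_ {s′} b i e) s a = sameSort s′ s ∧ does (b ℕₚ.≟ a)
writes (c₁ ⨾ c₂)          s a = writes c₁ s a ∨ writes c₂ s a
writes (cond b c₁ c₂)     s a = writes c₁ s a ∨ writes c₂ s a
writes (while b c)        s a = writes c s a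

∨-false : ∀ x {y} → x ∨ y ≡ false → x ≡ false × y ≡ false
∨-false false eq = refl , eq

module Hoare (R : Reals) {n d : ℕ} (S : Fin n → Geometry.Point R d) where
  open Reals R using (ℝ)
  open Execution R S

  frame : ∀ {c σ σ′ t} s a → writes c s a ≡ false → ⟨ c , σ ⟩⇓[ t ] σ′ →
          ∀ i → σ′ s a i ≡ σ s a i
  frame s a w ⇓-skip i = refl
  frame nat a w (⇓-assign {nat} {b}) i rewrite w = refl
  frame real a w (⇓-assign {nat} {b}) i = refl
  frame nat a w (⇓-assign {real} {b}) i = refl
  frame real a w (⇓-assign {real} {b}) i rewrite w = refl
  frame s a w (⇓-seq {c₁} r₁ r₂) i with w₁ , w₂ ← ∨-false (writes c₁ s a) w =
    trans (frame s a w₂ r₂ i) (frame s a w₁ r₁ i)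
  frame s a w (⇓-then {c₁ = c₁} _ r) = frame s a (proj₁ (∨-false (writes c₁ s a) w)) r
  frame s a w (⇓-else {c₁ = c₁} _ r) = frame s a (proj₂ (∨-false (writes c₁ s a) w)) r
  frame s a w (⇓-exit _) i = refl
  frame s a w (⇓-loop _ r₁ r₂) i = trans (frame s a w r₂ i) (frame s a w r₁ i)

  set-≡ : ∀ {A : Set} (f : ℕ → ℕ → A) a i v → set f a i v a i ≡ v
  set-≡ f a i v rewrite dec-true (a ℕₚ.≟ a) refl | dec-true (i ℕₚ.≟ i) refl = refl

  set-≢ : ∀ {A : Set} (f : ℕ → ℕ → A) a {i j} v → i ≢ j → set f a i v a j ≡ f a j
  set-≢ f a {i} {j} v i≢j rewrite dec-true (a ℕₚ.≟ a) refl | dec-false (i ℕₚ.≟ j) i≢j = refl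

  record Halts (c : Program) (σ : Store) (Q : ℕ → Store → Set) : Set where
    constructor halts
    field
      {time}  : ℕ
      {final} : Store
      run     : ⟨ c , σ ⟩⇓[ time ] final
      post    : Q time final

  weaken : ∀ {c σ} {P Q : ℕ → Store → Set} → (∀ {t σ′} → P t σ′ → Q t σ′) → Halts c σ P → Halts c σ Q
  weaken P⇒Q (halts r post) = halts r (P⇒Q post)

  module _ {b : Test} {c : Program} (I : ℕ → Store → Set) (N : ℕ) where

    -- τ x bounds the time of the first x iterations, and N bounds their number.
    while-rule : (τ : ℕ → ℕ) →
      (∀ x σ → I x σ → test σ b ≡ true →
        x ℕ.< N × Halts c σ λ t σ′ → τ x ℕ.+ (costTest b ℕ.+ t) ℕ.≤ τ (suc x) × I (suc x) σ′) →
      ∀ σ → I 0 σ → Halts (while b c) σ λ t σ′ →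
        ∃[ x ] x ℕ.≤ N × I x σ′ × test σ′ b ≡ false × τ 0 ℕ.+ t ℕ.≤ τ x ℕ.+ costTest b
    while-rule τ step σ i₀ = go N 0 σ (ℕₚ.+-identityʳ N) i₀
      where
      -- Recursion on the number of iterations still allowed. It cannot run out while the test
      -- holds, as `step` then yields y < N.
      go : ∀ fuel y σ → fuel ℕ.+ y ≡ N → I y σ → Halts (while b c) σ λ t σ′ →
        ∃[ x ] x ℕ.≤ N × I x σ′ × test σ′ b ≡ false × τ y ℕ.+ t ℕ.≤ τ x ℕ.+ costTest b
      go fuel y σ fuel+y≡N i with test σ b in eq
      ... | false = halts (⇓-exit eq)
              (y , subst (y ℕ.≤_) fuel+y≡N (ℕₚ.m≤n+m y fuel) , i , eq , ℕₚ.≤-refl)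
      ... | true with fuel | step y σ i eq
      ...   | zero     | y<N , _ = contradiction fuel+y≡N (ℕₚ.<⇒≢ y<N)
      ...   | suc fuel | _ , halts {t₁} r₁ (τy+t₁≤τ1+y , i′)
              with halts {t₂} r₂ (x , x≤N , i″ , exit , τ1+y+t₂≤τx)
                ← go fuel (suc y) _ (trans (ℕₚ.+-suc fuel y) fuel+y≡N) i′
              = halts (⇓-loop eq r₁ r₂) (x , x≤N , i″ , exit , (begin
                  τ y ℕ.+ (costTest b ℕ.+ t₁ ℕ.+ t₂)   ≡⟨ ℕₚ.+-assoc (τ y) _ t₂ ⟨
                  τ y ℕ.+ (costTest b ℕ.+ t₁) ℕ.+ t₂   ≤⟨ ℕₚ.+-monoˡ-≤ t₂ τy+t₁≤τ1+y ⟩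
                  τ (suc y) ℕ.+ t₂                     ≤⟨ τ1+y+t₂≤τx ⟩
                  τ x ℕ.+ costTest b                   ∎))
              where open ℕₚ.≤-Reasoning

    -- Suffices for every loop except `encodePoints`, whose body is expensive for the few points of
    -- the slab and cheap for the others. The time is stated with the actual number x of iterations,
    -- so N may be crude, such as d for the loop that finds the logarithm.
    while-uniform : ∀ T →
      (∀ x σ → I x σ → test σ b ≡ true →
        x ℕ.< N × Halts c σ λ t σ′ → t ℕ.≤ T × I (suc x) σ′) →
      ∀ σ → I 0 σ → Halts (while b c) σ λ t σ′ →
        ∃[ x ] x ℕ.≤ N × I x σ′ × test σ′ b ≡ false × t ℕ.≤ x ℕ.* (costTest b ℕ.+ T) ℕ.+ costTest b
    while-uniform T step = while-rule (ℕ._* (costTest b ℕ.+ T)) λ x σ i eq →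
      let x<N , body = step x σ i eq in
      x<N , weaken (λ { (t≤T , i′) → time≤ x t≤T , i′ }) body
      where
      time≤ : ∀ x {t} → t ℕ.≤ T →
        x ℕ.* (costTest b ℕ.+ T) ℕ.+ (costTest b ℕ.+ t) ℕ.≤ suc x ℕ.* (costTest b ℕ.+ T)
      time≤ x t≤T = ℕₚ.≤-trans
        (ℕₚ.+-monoʳ-≤ (x ℕ.* (costTest b ℕ.+ T)) (ℕₚ.+-monoʳ-≤ (costTest b) t≤T))
        (ℕₚ.≤-reflexive (ℕₚ.+-comm (x ℕ.* (costTest b ℕ.+ T)) (costTest b ℕ.+ T)))

-- The program

var : ℕ → Expr nat
var a = a ⟦ lit 0 ⟧

1+_ : Expr nat → Expr nat
1+ e = lit 1 ⊕ e

infix 3 _≔_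
_≔_ : ℕ → Expr nat → Program
a ≔ e = a ⟦ lit 0 ⟧≔ e

-- SLABS holds the number of slabs minus one.
pattern LEVELS  = 0
pattern POWER   = 1
pattern SLABS   = 2
pattern PT      = 3
pattern SLAB    = 4
pattern AXIS    = 5
pattern COUNT   = 6
pattern CODE    = 7
pattern TABLE   = 8
pattern PARTNER = 9
pattern LO = 0
pattern HI = 1

bucketE : Expr nat
bucketE = floor (cast (1+ var SLABS) ⊛ coord (var PT) (lit 0))

midE : Expr nat → Expr real
midE i = (LO ⟦ i ⟧ ⊞ HI ⟦ i ⟧) ⊘ cast (lit 2)

computeLevels computeSlabs countPoints findSlab unitBox restrictToSlab : Program
extendCodes encodePoints findCollision output : Program
computeLevels =
  -- All tests are strict, so 2 P ≤ d is written as 2 P < d + 1.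
  while (lit 2 ⊗ var POWER ≺ 1+ #dim)
    ( POWER  ≔ lit 2 ⊗ var POWER ⨾
      LEVELS ≔ 1+ var LEVELS )
computeSlabs =
  while ((1+ var SLABS) ⊗ (1+ var LEVELS) ≺ 1+ #points)
    (SLABS ≔ 1+ var SLABS)
countPoints =
  while (var PT ≺ #points)
    ( COUNT ⟦ bucketE ⟧≔ 1+ (COUNT ⟦ bucketE ⟧) ⨾
      PT ≔ 1+ var PT )
findSlab =
  while (var LEVELS ≺ COUNT ⟦ var SLAB ⟧)
    (SLAB ≔ 1+ var SLAB)
-- Loops over the axes include the virtual axis d, hence the bound 1+ #dim.
unitBox =
  while (var AXIS ≺ 1+ #dim)
    -- The lower ends are already 0 in cleared memory. On the virtual axis, the side from 0 to 1 has
    -- its middle above 0, the value that `coord` reads there.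
    ( HI ⟦ var AXIS ⟧≔ cast (lit 1) ⨾
      AXIS ≔ 1+ var AXIS )
restrictToSlab =
  LO ⟦ lit 0 ⟧≔ cast (var SLAB) ⊘ cast (1+ var SLABS) ⨾
  HI ⟦ lit 0 ⟧≔ cast (1+ var SLAB) ⊘ cast (1+ var SLABS)
extendCodes =
  while (var AXIS ≺ 1+ #dim)
    ( cond (midE (var AXIS) ≺ coord (var PT) (var AXIS))
        (CODE ⟦ var AXIS ⟧≔ 1+ (lit 2 ⊗ CODE ⟦ var AXIS ⟧))
        (CODE ⟦ var AXIS ⟧≔ lit 2 ⊗ CODE ⟦ var AXIS ⟧) ⨾
      AXIS ≔ 1+ var AXIS )
encodePoints =
  while (var PT ≺ #points)
    -- Equality of bucket and slab, expressed by a strict test: with truncated subtraction, the two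
    -- differences add up to the distance.
    ( cond ((bucketE ∸ var SLAB) ⊕ (var SLAB ∸ bucketE) ≺ lit 1)
        (AXIS ≔ lit 0 ⨾ extendCodes)
        skip ⨾
      PT ≔ 1+ var PT )
findCollision =
  -- No test bounds the axis: the pigeonhole principle stops the loop at the virtual axis d at the
  -- latest.
  while (TABLE ⟦ CODE ⟦ var AXIS ⟧ ⟧ ≺ lit 1)
    ( TABLE ⟦ CODE ⟦ var AXIS ⟧ ⟧≔ 1+ var AXIS ⨾
      AXIS ≔ 1+ var AXIS )
output =
  PARTNER ≔ TABLE ⟦ CODE ⟦ var AXIS ⟧ ⟧ ∸ lit 1 ⨾
  LO ⟦ var PARTNER ⟧≔ midE (var PARTNER) ⨾
  -- If the axis is the virtual one, this changes only cell d, which is not part of the output box.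
  HI ⟦ var AXIS ⟧≔ midE (var AXIS)

program : Program
program =
  POWER ≔ lit 1 ⨾ computeLevels ⨾ computeSlabs ⨾ countPoints ⨾ findSlab ⨾
  unitBox ⨾ restrictToSlab ⨾
  PT ≔ lit 0 ⨾ encodePoints ⨾
  AXIS ≔ lit 0 ⨾ findCollision ⨾
  output

-- Correctness and running time of each loop

module Stages (R : Reals) {n d : ℕ} (S : Fin n → Geometry.Point R d) where
  open Reals R
  open Execution R S
  open Hoare R S
  open OrderedFieldProperties orderedField using (midpoint)

  bucket : ℕ → ℕ → ℕ
  bucket m p = clamp ⌊ fromℕ (suc m) * input p 0 ⌋

  bit : (lo hi : ℕ → ℝ) → ℕ → ℕ → Bool
  bit lo hi i p = does (midpoint (lo i) (hi i) <? input p i)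

  -- Settles comparisons of closed costs by evaluation: the implicit argument reduces to the unit
  -- type and is filled in automatically.
  steps : ∀ {t u} {_ : Bool.T (t ℕ.≤ᵇ u)} → t ℕ.≤ u
  steps {_} {_} {t≤ᵇu} = ℕₚ.≤ᵇ⇒≤ _ _ t≤ᵇu

  -- Of the 20 steps per iteration, 8 belong to the test and 12 to the body; the final 8 are the
  -- failing test. The constants of the other uniform loops arise in the same way.
  computeLevels-halts : ∀ σ → 1 ℕ.≤ d → σ nat LEVELS 0 ≡ 0 → σ nat POWER 0 ≡ 1 →
    Halts computeLevels σ λ t σ′ → let k = σ′ nat LEVELS 0 in
      2 ℕ.^ k ℕ.≤ d × d ℕ.< 2 ℕ.^ suc k × t ℕ.≤ k ℕ.* 20 ℕ.+ 8
  computeLevels-halts σ 1≤d k≡0 p≡1 = weaken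
    (λ { (x , _ , (refl , p≡2^k , 2^k≤d) , exit , t≤) → 2^k≤d , ℕₚ.≰⇒> (λ 2*2^k≤d → does-false (_ ℕₚ.<? suc d) exit
        (ℕ.s≤s (subst (λ p → 2 ℕ.* p ℕ.≤ d) (sym p≡2^k) 2*2^k≤d))) , t≤ })
    (while-uniform I d 12 step σ (k≡0 , p≡1 , 1≤d))
    where
    I : ℕ → Store → Set
    I x σ = σ nat LEVELS 0 ≡ x × σ nat POWER 0 ≡ 2 ℕ.^ x × 2 ℕ.^ x ℕ.≤ d
    step : ∀ x σ → I x σ → test σ (lit 2 ⊗ var POWER ≺ 1+ #dim) ≡ true → x ℕ.< d × _
    step x σ (k≡x , p≡2^x , 2^x≤d) eq =
      ℕₚ.<-≤-trans (n<2^n x) 2^x≤d , halts (⇓-seq ⇓-assign ⇓-assign)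
        ( steps , cong suc k≡x , cong (2 ℕ.*_) p≡2^x
        , ℕ.s≤s⁻¹ (subst (λ p → 2 ℕ.* p ℕ.< suc d) p≡2^x (does-true (_ ℕₚ.<? _) eq)))

  computeSlabs-halts : ∀ {k} σ → σ nat LEVELS 0 ≡ k → σ nat SLABS 0 ≡ 0 →
    Halts computeSlabs σ λ t σ′ → let m = σ′ nat SLABS 0 in
      m ℕ.* suc k ℕ.≤ n × n ℕ.< suc m ℕ.* suc k × t ℕ.≤ m ℕ.* 19 ℕ.+ 13
  computeSlabs-halts {k} σ k≡ m≡0 = weaken
    (λ { (x , _ , (refl , k≡ , m*k≤n) , exit , t≤) →
      m*k≤n ,
      ℕₚ.≰⇒> (λ m*k≤n → does-false (_ ℕₚ.<? suc n) exit
        (ℕ.s≤s (subst (λ k → suc x ℕ.* suc k ℕ.≤ n) (sym k≡) m*k≤n))) ,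
      t≤ })
    (while-uniform I n 6 step σ (m≡0 , k≡ , ℕ.z≤n))
    where
    I : ℕ → Store → Set
    I x σ = σ nat SLABS 0 ≡ x × σ nat LEVELS 0 ≡ k × x ℕ.* suc k ℕ.≤ n
    step : ∀ x σ → I x σ → test σ ((1+ var SLABS) ⊗ (1+ var LEVELS) ≺ 1+ #points) ≡ true → x ℕ.< n × _
    step x σ (m≡x , k≡ , _) eq =
      ℕₚ.≤-trans (ℕₚ.m≤m*n (suc x) (suc k)) m*k≤n , halts ⇓-assign (steps , cong suc m≡x , k≡ , m*k≤n)
      where
      m*k≤n : suc x ℕ.* suc k ℕ.≤ n
      m*k≤n = ℕ.s≤s⁻¹ (subst₂ (λ m k → suc m ℕ.* suc k ℕ.< suc n) m≡x k≡ (does-true (_ ℕₚ.<? _) eq))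

  countPoints-halts : ∀ {m} σ → σ nat SLABS 0 ≡ m → σ nat PT 0 ≡ 0 → (∀ v → σ nat COUNT v ≡ 0) →
    Halts countPoints σ λ t σ′ → (∀ v → σ′ nat COUNT v ≡ Counting.count (bucket m) v n) × t ℕ.≤ n ℕ.* 36 ℕ.+ 4
  countPoints-halts {m} σ m≡ p≡0 count≡0 = weaken
    (λ { (x , x≤n , (m≡ , p≡x , count≡) , exit , t≤) →
      let x≡n = ℕₚ.≤-antisym x≤n (ℕₚ.≮⇒≥ λ x<n → does-false (_ ℕₚ.<? n) exit (subst (ℕ._< n) (sym p≡x) x<n)) in
      (λ v → trans (count≡ v) (cong (count v) x≡n)) ,
      ℕₚ.≤-trans t≤ (ℕₚ.≤-reflexive (cong (λ x → x ℕ.* 36 ℕ.+ 4) x≡n)) })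
    (while-uniform I n 32 step σ (m≡ , p≡0 , count≡0))
    where
    open Counting (bucket m)
    I : ℕ → Store → Set
    I x σ = σ nat SLABS 0 ≡ m × σ nat PT 0 ≡ x × (∀ v → σ nat COUNT v ≡ count v x)
    step : ∀ x σ → I x σ → test σ (var PT ≺ #points) ≡ true → x ℕ.< n × _
    step x σ (m≡ , p≡x , count≡) eq =
      subst (ℕ._< n) p≡x (does-true (_ ℕₚ.<? n) eq) ,
      halts (⇓-seq ⇓-assign ⇓-assign) (steps , m≡ , cong suc p≡x , count≡′)
      where
      b : ℕ
      b = bucket (σ nat SLABS 0) (σ nat PT 0)
      b≡ : b ≡ bucket m x
      b≡ = cong₂ bucket m≡ p≡x
      count≡′ : ∀ v → set (σ nat) COUNT b (suc (σ nat COUNT b)) COUNT v ≡ count v (suc x)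
      count≡′ v with bucket m x ℕₚ.≟ v
      ... | yes refl rewrite dec-true (bucket m x ℕₚ.≟ v) refl | b≡ =
        trans (set-≡ (σ nat) COUNT v _) (cong suc (count≡ v))
      ... | no b≢v rewrite dec-false (bucket m x ℕₚ.≟ v) b≢v | b≡ =
        trans (set-≢ (σ nat) COUNT _ b≢v) (count≡ v)

  -- The invariant says that all slabs passed so far hold more than k points. If this were so for
  -- all m + 1 slabs, there would be at least (m + 1)(k + 1) > n points.
  findSlab-halts : ∀ {k m} σ → σ nat LEVELS 0 ≡ k → σ nat SLAB 0 ≡ 0 →
    (∀ v → σ nat COUNT v ≡ Counting.count (bucket m) v n) → n ℕ.< suc m ℕ.* suc k →
    Halts findSlab σ λ t σ′ → let s = σ′ nat SLAB 0 in
      s ℕ.≤ m × Counting.count (bucket m) s n ℕ.≤ k × t ℕ.≤ s ℕ.* 12 ℕ.+ 6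
  findSlab-halts {k} {m} σ k≡ s≡0 count≡ n<m*k = weaken
    (λ { (x , x≤m , (refl , k≡ , count≡ , _) , exit , t≤) →
      x≤m ,
      subst₂ ℕ._≤_ (count≡ x) k≡ (ℕₚ.≮⇒≥ (does-false (_ ℕₚ.<? _) exit)) ,
      t≤ })
    (while-uniform I m 6 step σ (s≡0 , k≡ , count≡ , λ _ ()))
    where
    open Counting (bucket m)
    I : ℕ → Store → Set
    I x σ = σ nat SLAB 0 ≡ x × σ nat LEVELS 0 ≡ k × (∀ v → σ nat COUNT v ≡ count v n) ×
            (∀ y → y ℕ.< x → k ℕ.< count y n)
    step : ∀ x σ → I x σ → test σ (var LEVELS ≺ COUNT ⟦ var SLAB ⟧) ≡ true → x ℕ.< m × _
    step x σ (s≡x , k≡ , count≡ , full) eq =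
      ℕₚ.≰⇒> (λ m≤x → ℕₚ.<⇒≱ n<m*k (count-pigeonhole (suc m) λ v v≤m → full′ v (ℕₚ.≤-trans v≤m (ℕ.s≤s m≤x)))) ,
      halts ⇓-assign (steps , cong suc s≡x , k≡ , count≡ , full′)
      where
      full′ : ∀ y → y ℕ.< suc x → k ℕ.< count y n
      full′ y y<1+x with y ℕₚ.≟ x
      ... | yes refl = subst₂ ℕ._<_ k≡ (trans (cong (σ nat COUNT) s≡x) (count≡ y)) (does-true (_ ℕₚ.<? _) eq)
      ... | no y≢x   = full y (ℕₚ.≤∧≢⇒< (ℕ.s≤s⁻¹ y<1+x) y≢x)

  unitBox-halts : ∀ σ → σ nat AXIS 0 ≡ 0 →
    Halts unitBox σ λ t σ′ → (∀ x → x ℕ.≤ d → σ′ real HI x ≡ fromℕ 1) × t ℕ.≤ suc d ℕ.* 17 ℕ.+ 6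
  unitBox-halts σ i≡0 = weaken
    (λ { (x , x≤1+d , (i≡x , hi≡1) , exit , t≤) →
      let 1+d≤x = ℕₚ.≮⇒≥ λ x<1+d → does-false (_ ℕₚ.<? suc d) exit (subst (ℕ._< suc d) (sym i≡x) x<1+d) in
      (λ y y≤d → hi≡1 y (ℕₚ.≤-trans (ℕ.s≤s y≤d) 1+d≤x)) ,
      ℕₚ.≤-trans t≤ (ℕₚ.+-monoˡ-≤ 6 (ℕₚ.*-monoˡ-≤ 17 x≤1+d)) })
    (while-uniform I (suc d) 11 step σ (i≡0 , λ _ ()))
    where
    I : ℕ → Store → Set
    I x σ = σ nat AXIS 0 ≡ x × (∀ y → y ℕ.< x → σ real HI y ≡ fromℕ 1)
    step : ∀ x σ → I x σ → test σ (var AXIS ≺ 1+ #dim) ≡ true → x ℕ.< suc d × _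
    step x σ (i≡x , hi≡1) eq =
      subst (ℕ._< suc d) i≡x (does-true (_ ℕₚ.<? suc d) eq) ,
      halts (⇓-seq ⇓-assign ⇓-assign) (steps , cong suc i≡x , hi≡1′)
      where
      hi≡1′ : ∀ y → y ℕ.< suc x → set (σ real) HI (σ nat AXIS 0) (fromℕ 1) HI y ≡ fromℕ 1
      hi≡1′ y y<1+x with x ℕₚ.≟ y
      ... | yes refl rewrite i≡x = set-≡ (σ real) HI y _
      ... | no x≢y   rewrite i≡x = trans (set-≢ (σ real) HI _ x≢y)
        (hi≡1 y (ℕₚ.≤∧≢⇒< (ℕ.s≤s⁻¹ y<1+x) (≢-sym x≢y)))

  extendCodes-halts : ∀ σ → σ nat AXIS 0 ≡ 0 →
    Halts extendCodes σ λ t σ′ → σ′ real ≡ σ real ×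
      (∀ x → x ℕ.≤ d → σ′ nat CODE x ≡ shift (bit (σ real LO) (σ real HI) x (σ nat PT 0)) (σ nat CODE x)) ×
      t ℕ.≤ suc d ℕ.* 38 ℕ.+ 6
  extendCodes-halts σ₀ i≡0 = weaken
    (λ { (x , x≤1+d , (i≡x , real≡ , _ , done , _) , exit , t≤) →
      let 1+d≤x = ℕₚ.≮⇒≥ λ x<1+d → does-false (_ ℕₚ.<? suc d) exit (subst (ℕ._< suc d) (sym i≡x) x<1+d) in
      real≡ , (λ y y≤d → done y (ℕₚ.≤-trans (ℕ.s≤s y≤d) 1+d≤x)) ,
      ℕₚ.≤-trans t≤ (ℕₚ.+-monoˡ-≤ 6 (ℕₚ.*-monoˡ-≤ 38 x≤1+d)) })
    (while-uniform I (suc d) 32 step σ₀ (i≡0 , refl , refl , (λ _ ()) , (λ _ _ → refl)))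
    where
    new : ℕ → ℕ
    new x = shift (bit (σ₀ real LO) (σ₀ real HI) x (σ₀ nat PT 0)) (σ₀ nat CODE x)
    I : ℕ → Store → Set
    -- Axes below x carry the extended code and the others still the old one, which the body is
    -- about to read. The real memory is equated as a whole function, so that arguments of `code`
    -- can be rewritten directly.
    I x σ = σ nat AXIS 0 ≡ x × σ real ≡ σ₀ real × σ nat PT 0 ≡ σ₀ nat PT 0 ×
            (∀ y → y ℕ.< x → σ nat CODE y ≡ new y) × (∀ y → x ℕ.≤ y → σ nat CODE y ≡ σ₀ nat CODE y)
    module _ (σ : Store) where
      i = σ nat AXIS 0
      v = shift (bit (σ real LO) (σ real HI) i (σ nat PT 0)) (σ nat CODE i)
      append : Halts _ σ λ t σ′ → t ℕ.≤ 26 × σ′ ≡ update nat σ CODE i v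
      append with test σ (midE (var AXIS) ≺ coord (var PT) (var AXIS)) in eq
      ... | true  = halts (⇓-then eq ⇓-assign) (steps , refl)
      ... | false = halts (⇓-else eq ⇓-assign) (steps , refl)
    step : ∀ x σ → I x σ → test σ (var AXIS ≺ 1+ #dim) ≡ true → x ℕ.< suc d × _
    step x σ (i≡x , real≡ , p≡ , done , todo) eq
      with halts r (t≤26 , refl) ← append σ =
      subst (ℕ._< suc d) i≡x (does-true (_ ℕₚ.<? suc d) eq) ,
      halts (⇓-seq r ⇓-assign) (ℕₚ.+-monoˡ-≤ 6 t≤26 , cong suc i≡x , real≡ , p≡ , done′ , todo′)
      where
      v≡new : v σ ≡ new x
      v≡new rewrite i≡x | real≡ | p≡ = cong (shift (bit (σ₀ real LO) (σ₀ real HI) x (σ₀ nat PT 0))) (todo x ℕₚ.≤-refl)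
      done′ : ∀ y → y ℕ.< suc x → set (σ nat) CODE (i σ) (v σ) CODE y ≡ new y
      done′ y y<1+x with x ℕₚ.≟ y
      ... | yes refl = subst (λ i → set (σ nat) CODE i (v σ) CODE x ≡ new x) (sym i≡x)
                         (trans (set-≡ (σ nat) CODE x (v σ)) v≡new)
      ... | no x≢y   = trans (set-≢ (σ nat) CODE (v σ) (x≢y ∘ trans (sym i≡x)))
                         (done y (ℕₚ.≤∧≢⇒< (ℕ.s≤s⁻¹ y<1+x) (≢-sym x≢y)))
      todo′ : ∀ y → suc x ℕ.≤ y → set (σ nat) CODE (i σ) (v σ) CODE y ≡ σ₀ nat CODE y
      todo′ y x<y = trans (set-≢ (σ nat) CODE (v σ) (ℕₚ.<⇒≢ x<y ∘ trans (sym i≡x))) (todo y (ℕₚ.<⇒≤ x<y))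

  module _ (b : ℕ → ℕ) (s : ℕ) (A D : ℕ) where
    open Counting b

    -- An amortised bound: each scanned point costs A, and a point of slab s costs D more. With D of
    -- order d and at most k such points, the surcharge totals O(d k).
    scanTime : ℕ → ℕ
    scanTime x = x ℕ.* A ℕ.+ count s x ℕ.* D

    scanTime-hit : ∀ {x} → b x ≡ s → scanTime (suc x) ≡ scanTime x ℕ.+ (A ℕ.+ D)
    scanTime-hit {x} bx≡s = trans (cong (λ c → suc x ℕ.* A ℕ.+ c ℕ.* D) (count-hit bx≡s))
      (solve 4 (λ A D x c → (con 1 :+ x) :* A :+ (con 1 :+ c) :* D := x :* A :+ c :* D :+ (A :+ D))
        refl A D x (count s x))
      where open +-*-Solver

    scanTime-miss : ∀ {x} → b x ≢ s → scanTime (suc x) ≡ scanTime x ℕ.+ A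
    scanTime-miss {x} bx≢s = trans (cong (λ c → suc x ℕ.* A ℕ.+ c ℕ.* D) (count-miss bx≢s))
      (solve 4 (λ A D x c → (con 1 :+ x) :* A :+ c :* D := x :* A :+ c :* D :+ A)
        refl A D x (count s x))
      where open +-*-Solver

  encodePoints-halts : ∀ {m s} σ → σ nat SLABS 0 ≡ m → σ nat SLAB 0 ≡ s → σ nat PT 0 ≡ 0 →
    (∀ x → σ nat CODE x ≡ 0) →
    Halts encodePoints σ λ t σ′ →
      (∀ x → x ℕ.≤ d → σ′ nat CODE x ≡ Coding.code (bucket m) s (bit (σ real LO) (σ real HI) x) n) ×
      t ℕ.≤ scanTime (bucket m) s 42 (suc d ℕ.* 38 ℕ.+ 8) n ℕ.+ 4
  encodePoints-halts {m} {s} σ₀ m≡ s≡ p≡0 code≡0 = weaken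
    (λ { (x , x≤n , (m≡ , s≡ , p≡x , real≡ , code≡) , exit , t≤) →
      let x≡n = ℕₚ.≤-antisym x≤n (ℕₚ.≮⇒≥ λ x<n → does-false (_ ℕₚ.<? n) exit (subst (ℕ._< n) (sym p≡x) x<n)) in
      (λ y y≤d → trans (code≡ y y≤d) (cong (code _) x≡n)) ,
      ℕₚ.≤-trans t≤ (ℕₚ.≤-reflexive (cong (λ x → τ x ℕ.+ 4) x≡n)) })
    (while-rule I n τ step σ₀ (m≡ , s≡ , p≡0 , refl , λ x _ → code≡0 x))
    where
    open Counting (bucket m)
    open Coding (bucket m) s
    D : ℕ
    -- Resetting the axis takes 3 steps and `extendCodes` at most 38 (d + 1) + 6, in place of the
    -- single step of `skip`.
    D = suc d ℕ.* 38 ℕ.+ 8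
    τ : ℕ → ℕ
    τ = scanTime (bucket m) s 42 D
    I : ℕ → Store → Set
    I x σ = σ nat SLABS 0 ≡ m × σ nat SLAB 0 ≡ s × σ nat PT 0 ≡ x × σ real ≡ σ₀ real ×
            (∀ y → y ℕ.≤ d → σ nat CODE y ≡ code (bit (σ₀ real LO) (σ₀ real HI) y) x)
    step : ∀ x σ → I x σ → test σ (var PT ≺ #points) ≡ true → x ℕ.< n ×
      Halts _ σ λ t σ′ → τ x ℕ.+ (4 ℕ.+ t) ℕ.≤ τ (suc x) × I (suc x) σ′
    step x σ (m≡ , s≡ , p≡x , real≡ , code≡) eq =
      subst (ℕ._< n) p≡x (does-true (_ ℕₚ.<? n) eq) , body (bucket m x ℕₚ.≟ s)
      where
      b u : ℕ
      b = bucket (σ nat SLABS 0) (σ nat PT 0)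
      u = σ nat SLAB 0
      b≡ : b ≡ bucket m x
      b≡ = cong₂ bucket m≡ p≡x
      σ₁ : Store
      σ₁ = update nat σ AXIS 0 0
      apart : b ≢ u → ¬ (b ℕ.∸ u ℕ.+ (u ℕ.∸ b) ℕ.< 1)
      apart b≢u lt = let z = ℕₚ.n<1⇒n≡0 lt in b≢u (ℕₚ.≤-antisym
        (ℕₚ.m∸n≡0⇒m≤n (ℕₚ.m+n≡0⇒m≡0 _ z)) (ℕₚ.m∸n≡0⇒m≤n (ℕₚ.m+n≡0⇒n≡0 (b ℕ.∸ u) z)))
      together : b ≡ u → b ℕ.∸ u ℕ.+ (u ℕ.∸ b) ℕ.< 1
      together b≡u = ℕ.s≤s (ℕₚ.≤-reflexive (cong₂ ℕ._+_
        (ℕₚ.m≤n⇒m∸n≡0 (ℕₚ.≤-reflexive b≡u)) (ℕₚ.m≤n⇒m∸n≡0 (ℕₚ.≤-reflexive (sym b≡u)))))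
      body : Dec (bucket m x ≡ s) → Halts _ σ λ t σ′ → τ x ℕ.+ (4 ℕ.+ t) ℕ.≤ τ (suc x) × I (suc x) σ′
      body (no b≢s) = halts
        (⇓-seq (⇓-else (dec-false (_ ℕₚ.<? 1) (apart λ b≡u → b≢s (trans (sym b≡) (trans b≡u s≡)))) ⇓-skip) ⇓-assign)
        ( ℕₚ.≤-reflexive (sym (scanTime-miss (bucket m) s 42 D b≢s))
        , m≡ , s≡ , cong suc p≡x , real≡ , λ y y≤d → trans (code≡ y y≤d) (sym (code-miss b≢s)) )
      body (yes b≡s) with halts {t} r (real≡′ , code≡′ , t≤) ← extendCodes-halts σ₁ refl = halts
        (⇓-seq (⇓-then (dec-true (_ ℕₚ.<? 1) (together (trans b≡ (trans b≡s (sym s≡))))) (⇓-seq ⇓-assign r)) ⇓-assign)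
        ( ℕₚ.≤-trans (ℕₚ.+-monoʳ-≤ (τ x) (time≤ {E = suc d ℕ.* 38} t≤)) (ℕₚ.≤-reflexive (sym (scanTime-hit (bucket m) s 42 D b≡s)))
        , trans (frame nat SLABS refl r 0) m≡ , trans (frame nat SLAB refl r 0) s≡
        , cong suc (trans (frame nat PT refl r 0) p≡x)
        , trans real≡′ real≡
        , λ y y≤d → trans (code≡′ y y≤d) (code≡″ y y≤d) )
        where
        time≤ : ∀ {t E} → t ℕ.≤ E ℕ.+ 6 → 4 ℕ.+ (31 ℕ.+ (3 ℕ.+ t) ℕ.+ 6) ℕ.≤ 42 ℕ.+ (E ℕ.+ 8)
        time≤ {t} {E} t≤ = ℕₚ.+-monoʳ-≤ 38 (ℕₚ.≤-trans (ℕₚ.+-monoˡ-≤ 6 t≤)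
          (ℕₚ.≤-reflexive (solve 1 (λ E → E :+ con 6 :+ con 6 := con 4 :+ (E :+ con 8)) refl E)))
          where open +-*-Solver
        code≡″ : ∀ y → y ℕ.≤ d →
          shift (bit (σ real LO) (σ real HI) y (σ nat PT 0)) (σ nat CODE y) ≡
          code (bit (σ₀ real LO) (σ₀ real HI) y) (suc x)
        code≡″ y y≤d = trans
          (cong₂ shift (cong₂ (λ ρ p → bit (ρ LO) (ρ HI) y p) real≡ p≡x) (code≡ y y≤d))
          (sym (code-hit b≡s))

  findCollision-halts : ∀ σ → σ nat AXIS 0 ≡ 0 → (∀ v → σ nat TABLE v ≡ 0) →
    let f = σ nat CODE in (∀ x → x ℕ.≤ d → f x ℕ.< d) →
    Halts findCollision σ λ t σ′ → let i = σ′ nat AXIS 0 in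
      ∃[ j ] σ′ nat TABLE (f i) ≡ suc j × i ℕ.≤ d × j ℕ.< i × f j ≡ f i × t ℕ.≤ d ℕ.* 20 ℕ.+ 6
  findCollision-halts σ₀ i≡0 table≡0 f<d = weaken (λ {t} {σ} → post {t} {σ})
    (while-uniform I d 14 step σ₀ (i≡0 , refl , table≡0 , ℕ.z≤n , λ _ ()))
    where
    f : ℕ → ℕ
    f = σ₀ nat CODE
    open Table f
    I : ℕ → Store → Set
    I x σ = σ nat AXIS 0 ≡ x × σ nat CODE ≡ f × (∀ v → σ nat TABLE v ≡ table v x) × x ℕ.≤ d ×
            (∀ y → y ℕ.< x → table (f y) y ≡ 0)
    post : ∀ {t σ} → ∃[ x ] x ℕ.≤ d × I x σ × test σ (TABLE ⟦ CODE ⟦ var AXIS ⟧ ⟧ ≺ lit 1) ≡ false ×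
             t ℕ.≤ x ℕ.* 20 ℕ.+ 6 → let i = σ nat AXIS 0 in
           ∃[ j ] σ nat TABLE (f i) ≡ suc j × i ℕ.≤ d × j ℕ.< i × f j ≡ f i × t ℕ.≤ d ℕ.* 20 ℕ.+ 6
    post {σ = σ} (x , x≤d , (refl , code≡ , table≡ , _) , exit , t≤)
      rewrite code≡ with σ nat TABLE (f x) in eq
    ... | zero = contradiction (ℕ.s≤s ℕ.z≤n) (does-false (0 ℕₚ.<? 1) exit)
    ... | suc j with j<x , fj≡fx ← table-sound x (trans (sym (table≡ (f x))) eq) =
      j , refl , x≤d , j<x , fj≡fx , ℕₚ.≤-trans t≤ (ℕₚ.+-monoˡ-≤ 6 (ℕₚ.*-monoˡ-≤ 20 x≤d))
    step : ∀ x σ → I x σ → test σ (TABLE ⟦ CODE ⟦ var AXIS ⟧ ⟧ ≺ lit 1) ≡ true → x ℕ.< d × _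
    step x σ (i≡x , code≡ , table≡ , x≤d , none) eq =
      x<d , halts (⇓-seq ⇓-assign ⇓-assign) (steps , cong suc i≡x , code≡ , table≡′ , x<d , none′)
      where
      c : ℕ
      c = σ nat CODE (σ nat AXIS 0)
      c≡ : c ≡ f x
      c≡ = trans (cong (σ nat CODE) i≡x) (cong (λ f → f x) code≡)
      none′ : ∀ y → y ℕ.< suc x → table (f y) y ≡ 0
      none′ y y<1+x with y ℕₚ.≟ x
      ... | yes refl = trans (sym (table≡ (f y))) (trans (cong (σ nat TABLE) (sym c≡)) (ℕₚ.n<1⇒n≡0 (does-true (_ ℕₚ.<? 1) eq)))
      ... | no y≢x   = none y (ℕₚ.≤∧≢⇒< (ℕ.s≤s⁻¹ y<1+x) y≢x)
      x<d : x ℕ.< d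
      -- A failed lookup at x = d would complete d + 1 failed lookups.
      x<d = ℕₚ.≤∧≢⇒< x≤d λ x≡d → table-pigeonhole f<d λ y y≤d →
        none′ y (ℕ.s≤s (ℕₚ.≤-trans y≤d (ℕₚ.≤-reflexive (sym x≡d))))
      table≡′ : ∀ v → set (σ nat) TABLE c (suc (σ nat AXIS 0)) TABLE v ≡ table v (suc x)
      table≡′ v with f x ℕₚ.≟ v
      ... | yes refl rewrite dec-true (f x ℕₚ.≟ f x) refl | c≡ = trans (set-≡ (σ nat) TABLE (f x) _) (cong suc i≡x)
      ... | no fx≢v rewrite dec-false (f x ℕₚ.≟ v) fx≢v | c≡ = trans (set-≢ (σ nat) TABLE _ fx≢v) (table≡ v)

-- Geometry of the output box

module SlabBox (R : Reals) {n d : ℕ} (S : Fin n → Geometry.Point R d) where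
  open Reals R
  open Geometry R
  open Execution R S using (input)
  open Stages R S
  open OrderedFieldProperties orderedField
  open RealsProperties R
  open ≤-Reasoning

  input-≡ : ∀ p x → input (toℕ p) (toℕ x) ≡ S p x
  input-≡ p x with toℕ p ℕₚ.<? n | toℕ x ℕₚ.<? d
  ... | yes p<n | yes x<d = cong₂ S (Finₚ.fromℕ<-toℕ p p<n) (Finₚ.fromℕ<-toℕ x x<d)
  ... | yes _   | no x≮d  = contradiction (Finₚ.toℕ<n x) x≮d
  ... | no p≮n  | _       = contradiction (Finₚ.toℕ<n p) p≮n

  input-outside : ∀ p → input p d ≡ 0#
  input-outside p with p ℕₚ.<? n | d ℕₚ.<? d
  ... | yes _ | yes d<d = contradiction d<d (ℕₚ.<-irrefl refl)
  ... | yes _ | no _    = refl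
  ... | no _  | _       = refl

  module InSlab
    {m s : ℕ} (s≤m : s ℕ.≤ m) {lo hi : ℕ → ℝ}
    (lo-0 : lo 0 ≡ fromℕ s / fromℕ (suc m)) (lo-suc : ∀ x → lo (suc x) ≡ 0#)
    (hi-0 : hi 0 ≡ fromℕ (suc s) / fromℕ (suc m)) (hi-suc : ∀ x → x ℕ.< d → hi (suc x) ≡ fromℕ 1)
    where

    private
      c : ℝ
      c = fromℕ (suc m) ⁻¹

    width-0 : hi 0 - lo 0 ≡ c
    width-0 = x≡z+y⇒x-y≡z (begin-equality
      hi 0                    ≡⟨ hi-0 ⟩
      (1# + fromℕ s) * c      ≡⟨ distribʳ c 1# (fromℕ s) ⟩
      1# * c + fromℕ s * c    ≡⟨ cong₂ _+_ (*-identityˡ c) (sym lo-0) ⟩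
      c + lo 0                ∎)

    width-suc : ∀ x → x ℕ.< d → hi (suc x) - lo (suc x) ≡ 1#
    width-suc x x<d = x≡z+y⇒x-y≡z (trans (hi-suc x x<d) (cong (1# +_) (sym (lo-suc x))))

    0<width : ∀ x → x ℕ.≤ d → 0# < hi x - lo x
    0<width zero    _   = subst (0# <_) (sym width-0) (0<x⇒0<x⁻¹ (0<fromℕ m))
    0<width (suc x) x<d = subst (0# <_) (sym (width-suc x x<d)) 0<1

    0≤lo : ∀ x → 0# ≤ lo x
    0≤lo zero = begin
      0#              ≡⟨ zeroˡ c ⟨
      0# * c          ≤⟨ *-monoˡ-≤ (inj₁ (0<x⇒0<x⁻¹ (0<fromℕ m))) (0≤fromℕ s) ⟩
      fromℕ s * c     ≡⟨ lo-0 ⟨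
      lo 0            ∎
    0≤lo (suc x) = inj₂ (sym (lo-suc x))

    hi≤1 : ∀ x → x ℕ.≤ d → hi x ≤ 1#
    hi≤1 zero _ = subst (_≤ 1#) (sym hi-0) (y≤x*z⇒y/x≤z (0<fromℕ m)
      (subst (fromℕ (suc s) ≤_) (sym (*-identityʳ (fromℕ (suc m)))) (fromℕ-mono-≤ (ℕ.s≤s s≤m))))
    hi≤1 (suc x) x<d = inj₂ (trans (hi-suc x x<d) (+-identityʳ 1#))

    module Halved
      {i j : ℕ} (i≤d : i ℕ.≤ d) (j<i : j ℕ.< i) {lo′ hi′ : ℕ → ℝ}
      (lo′-j : lo′ j ≡ midpoint (lo j) (hi j)) (lo′-other : ∀ {x} → j ≢ x → lo′ x ≡ lo x)
      (hi′-i : hi′ i ≡ midpoint (lo i) (hi i)) (hi′-other : ∀ {x} → i ≢ x → hi′ x ≡ hi x)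
      where

      private
        i≢j : i ≢ j
        i≢j = ≢-sym (ℕₚ.<⇒≢ j<i)

        j<d : j ℕ.< d
        j<d = ℕₚ.<-≤-trans j<i i≤d

      -- The halvings are accounted for one after the other, through the intermediate widths
      -- `hi x - lo′ x`.
      width-j : ∀ {x} → j ≡ x → hi x - lo′ x ≡ ½ * (hi x - lo x)
      width-j refl = trans (cong (λ l → hi j - l) lo′-j) (y-midpoint (lo j) (hi j))

      width-i : ∀ {x} → i ≡ x → hi′ x - lo′ x ≡ ½ * (hi x - lo′ x)
      width-i refl = begin-equality
        hi′ i - lo′ i                         ≡⟨ cong₂ _-_ hi′-i (lo′-other (≢-sym i≢j)) ⟩
        midpoint (lo i) (hi i) - lo i         ≡⟨ midpoint-x (lo i) (hi i) ⟩
        ½ * (hi i - lo i)                     ≡⟨ cong (λ l → ½ * (hi i - l)) (lo′-other (≢-sym i≢j)) ⟨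
        ½ * (hi i - lo′ i)                    ∎

      0<width-lo′ : ∀ x → x ℕ.≤ d → 0# < hi x - lo′ x
      0<width-lo′ x x≤d with j ℕₚ.≟ x
      ... | yes j≡x = subst (0# <_) (sym (width-j j≡x)) (*-pos 0<½ (0<width x x≤d))
      ... | no j≢x  = subst (λ l → 0# < hi x - l) (sym (lo′-other j≢x)) (0<width x x≤d)

      0<width′ : ∀ x → x ℕ.≤ d → 0# < hi′ x - lo′ x
      0<width′ x x≤d with i ℕₚ.≟ x
      ... | yes i≡x = subst (0# <_) (sym (width-i i≡x)) (*-pos 0<½ (0<width-lo′ x x≤d))
      ... | no i≢x  = subst (λ h → 0# < h - lo′ x) (sym (hi′-other i≢x)) (0<width-lo′ x x≤d)

      lo≤lo′ : ∀ x → lo x ≤ lo′ x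
      lo≤lo′ x with j ℕₚ.≟ x
      ... | yes refl = subst (lo j ≤_) (sym lo′-j) (inj₁ (x<midpoint (0<y-x⇒x<y (0<width j (ℕₚ.<⇒≤ j<d)))))
      ... | no j≢x   = inj₂ (sym (lo′-other j≢x))

      hi′≤hi : ∀ x → hi′ x ≤ hi x
      hi′≤hi x with i ℕₚ.≟ x
      ... | yes refl = subst (_≤ hi i) (sym hi′-i) (inj₁ (midpoint<y (0<y-x⇒x<y (0<width i i≤d))))
      ... | no i≢x   = inj₂ (hi′-other i≢x)

      box : Box d
      box = record
        { lo    = lo′ ∘ toℕ
        ; hi    = hi′ ∘ toℕ
        ; lo<hi = λ x → 0<y-x⇒x<y (0<width′ (toℕ x) (ℕₚ.<⇒≤ (Finₚ.toℕ<n x)))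
        }

      box-inCube : ∀ y → y ∈ box → InUnitCube y
      box-inCube y y∈box x =
        inj₁ (≤-<-trans (≤-trans (0≤lo (toℕ x)) (lo≤lo′ (toℕ x))) (proj₁ (y∈box x))) ,
        inj₁ (<-≤-trans (proj₂ (y∈box x))
          (≤-trans (hi′≤hi (toℕ x)) (hi≤1 (toℕ x) (ℕₚ.<⇒≤ (Finₚ.toℕ<n x)))))

      product-width : 0 ℕ.< d → product {d} (λ x → hi (toℕ x) - lo (toℕ x)) ≡ c
      product-width (ℕ.s≤s {n = d-1} _) = begin-equality
        (hi 0 - lo 0) * product {d-1} (λ x → hi (suc (toℕ x)) - lo (suc (toℕ x)))
          ≡⟨ cong₂ _*_ width-0 (product-1 λ x → width-suc (toℕ x) (ℕₚ.m<n⇒m<1+n (Finₚ.toℕ<n x))) ⟩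
        c * 1#
          ≡⟨ *-identityʳ c ⟩
        c ∎

      volume-≥ : ½ * (½ * c) ≤ volume box
      volume-≥ = begin
        ½ * (½ * c)             ≡⟨ cong (λ v → ½ * (½ * v)) (product-width (ℕₚ.≤-<-trans ℕ.z≤n j<d)) ⟨
        ½ * (½ * product w)     ≡⟨ cong (½ *_) (product-scale jF ½ (width-j (sym jF≡j)) w₁≡w) ⟨
        ½ * product w₁          ≤⟨ ½*w₁≤w′ ⟩
        volume box              ∎
        where
        w w₁ w′ : Fin d → ℝ
        w  x = hi (toℕ x) - lo (toℕ x)
        w₁ x = hi (toℕ x) - lo′ (toℕ x)
        w′ x = hi′ (toℕ x) - lo′ (toℕ x)
        jF : Fin d
        jF = fromℕ< j<d
        jF≡j : toℕ jF ≡ j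
        jF≡j = Finₚ.toℕ-fromℕ< j<d
        w₁≡w : ∀ x → x ≢ jF → w₁ x ≡ w x
        w₁≡w x x≢j = cong (λ l → hi (toℕ x) - l) (lo′-other λ j≡x → x≢j (Finₚ.toℕ-injective (trans (sym j≡x) (sym jF≡j))))
        ½*w₁≤w′ : ½ * product w₁ ≤ product w′
        ½*w₁≤w′ with i ℕₚ.<? d
        ... | yes i<d = inj₂ (sym (product-scale iF ½ (width-i (sym iF≡i)) λ x x≢i →
                cong (_- lo′ (toℕ x)) (hi′-other λ i≡x → x≢i (Finₚ.toℕ-injective (trans (sym i≡x) (sym iF≡i))))))
          where
          iF : Fin d
          iF = fromℕ< i<d
          iF≡i : toℕ iF ≡ i
          iF≡i = Finₚ.toℕ-fromℕ< i<d
        -- On the virtual axis the second halving does not affect the volume, and the spare factor ½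
        -- is given away.
        ... | no i≮d = begin
          ½ * product w₁   ≤⟨ *-monoˡ-≤ (inj₁ (product-pos λ x → 0<width-lo′ (toℕ x) (ℕₚ.<⇒≤ (Finₚ.toℕ<n x)))) ½≤1 ⟩
          1# * product w₁  ≡⟨ *-identityˡ _ ⟩
          product w₁       ≡⟨ product-cong {f = w′} {w₁} (λ x → cong (_- lo′ (toℕ x)) (hi′-other λ { refl → i≮d (Finₚ.toℕ<n x) })) ⟨
          product w′       ∎
          where
          ½≤1 : ½ ≤ 1#
          ½≤1 = subst₂ _≤_ (+-identityʳ ½) ½+½≡1 (+-monoʳ-≤ ½ (inj₁ 0<½))

      -- A point of the box is above the middle along j, so its digit in the code of j is `true`.
      -- The same digit in the code of i puts it above the middle along i, where the box ends.
      box-empty : Coding.code (bucket m) s (bit lo hi j) n ≡ Coding.code (bucket m) s (bit lo hi i) n →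
        0 ℕ.< d → ∀ p → ¬ S p ∈ box
      box-empty code≡ 0<d p p∈box = ¬mid<i (does-true (_ <? _) bit-i)
        where
        q : ℕ
        q = toℕ p
        inside : ∀ {x} → x ℕ.< d → lo′ x < input q x × input q x < hi′ x
        inside {x} x<d = subst (λ x → lo′ x < input q x × input q x < hi′ x) (Finₚ.toℕ-fromℕ< x<d)
          (subst (λ z → lo′ (toℕ y) < z × z < hi′ (toℕ y)) (sym (input-≡ p y)) (p∈box y))
          where
          y : Fin d
          y = fromℕ< x<d
        -- Buckets are half-open slabs; the open box provides the strict inequalities that
        -- `floor-unique` needs.
        bucket≡s : bucket m q ≡ s
        bucket≡s = cong (Execution.clamp R S) (floor-unique
          (y/x<z⇒y<x*z (0<fromℕ m) (≤-<-trans (subst (_≤ lo′ 0) lo-0 (lo≤lo′ 0)) (proj₁ (inside 0<d))))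
          (z<y/x⇒x*z<y (0<fromℕ m) (<-≤-trans (proj₂ (inside 0<d)) (subst (hi′ 0 ≤_) hi-0 (hi′≤hi 0)))))
        bit-j : bit lo hi j q ≡ true
        bit-j = dec-true (_ <? _) (subst (_< input q j) lo′-j (proj₁ (inside j<d)))
        bit-i : bit lo hi i q ≡ true
        bit-i = trans (sym (Coding.code-injective (bucket m) s {bit lo hi j} {bit lo hi i} code≡ (Finₚ.toℕ<n p) bucket≡s)) bit-j
        -- On the virtual axis i = d the input reads as 0#, below the midpoint.
        ¬mid<i : ¬ midpoint (lo i) (hi i) < input q i
        ¬mid<i mid<i with ℕₚ.m≤n⇒m<n∨m≡n i≤d
        ... | inj₁ i<d  = <-asym mid<i (subst (input q i <_) hi′-i (proj₂ (inside i<d)))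
        ... | inj₂ refl = <-asym
          (subst (midpoint (lo i) (hi i) <_) (input-outside q) mid<i)
          (≤-<-trans (0≤lo i) (x<midpoint (0<y-x⇒x<y (0<width i i≤d))))

open import Data.Nat.Base using (_≤_)
open Geometry using (Point; IsPointSet; Box; IsEmptyBox)
open Execution using (Computes)
open Bounds using (TimeAtMost; VolumeAtLeast)

-- Adding up the running times

module Budget {w : ℕ} (1≤w : 1 ≤ w) where

  constant : ∀ c → c ≤ w ℕ.* c
  constant c = ℕₚ.m≤n*m c w {{ℕ.>-nonZero 1≤w}}

  add : ∀ {x y} A B → x ≤ w ℕ.* A → y ≤ w ℕ.* B → x ℕ.+ y ≤ w ℕ.* (A ℕ.+ B)
  add A B x≤ y≤ = ℕₚ.≤-trans (ℕₚ.+-mono-≤ x≤ y≤) (ℕₚ.≤-reflexive (sym (ℕₚ.*-distribˡ-+ w A B)))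

  linear : ∀ {t x} A B → t ≤ x ℕ.* A ℕ.+ B → x ≤ w → t ≤ w ℕ.* (A ℕ.+ B)
  linear A B t≤ x≤w = ℕₚ.≤-trans t≤ (add A B (ℕₚ.*-monoˡ-≤ A x≤w) (constant B))

module _ {n d k m s c : ℕ} (1≤d : 1 ≤ d) (1≤k : 1 ≤ k) (m≤n : m ≤ n) (s≤m : s ≤ m) (c≤k : c ≤ k) where
  private
    w : ℕ
    w = n ℕ.+ d ℕ.* k

    n≤w : n ≤ w
    n≤w = ℕₚ.m≤m+n n _

    d*k≤w : d ℕ.* k ≤ w
    d*k≤w = ℕₚ.m≤n+m _ n

    d≤w : d ≤ w
    d≤w = ℕₚ.≤-trans (ℕₚ.m≤m*n d k {{ℕ.>-nonZero 1≤k}}) d*k≤w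

    k≤w : k ≤ w
    k≤w = ℕₚ.≤-trans (ℕₚ.m≤n*m k d {{ℕ.>-nonZero 1≤d}}) d*k≤w

  open Budget {w} (ℕₚ.≤-trans 1≤k k≤w)

  -- Here the term d log d arises: c is the number of points in the slab, and each of them is
  -- compared with the middle along d + 1 axes.
  encoding-time : n ℕ.* 42 ℕ.+ c ℕ.* (suc d ℕ.* 38 ℕ.+ 8) ℕ.+ 4 ≤ w ℕ.* 130
  encoding-time = add 126 4
    (add 42 84 (ℕₚ.*-monoˡ-≤ 42 n≤w) (begin
      c ℕ.* (suc d ℕ.* 38 ℕ.+ 8)       ≤⟨ ℕₚ.*-monoˡ-≤ (suc d ℕ.* 38 ℕ.+ 8) c≤k ⟩
      k ℕ.* (suc d ℕ.* 38 ℕ.+ 8)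
        ≡⟨ solve 2 (λ k d → k :* ((con 1 :+ d) :* con 38 :+ con 8) := k :* con 46 :+ d :* k :* con 38) refl k d ⟩
      k ℕ.* 46 ℕ.+ d ℕ.* k ℕ.* 38      ≤⟨ add 46 38 (ℕₚ.*-monoˡ-≤ 46 k≤w) (ℕₚ.*-monoˡ-≤ 38 d*k≤w) ⟩
      w ℕ.* 84                         ∎))
    (constant 4)
    where
    open ℕₚ.≤-Reasoning
    open +-*-Solver

  -- The bare numerals on the left are the exact costs of the straight-line code between the loops.
  -- Charging every summand as a multiple of w, the multiples add up to 381.
  total-time : ∀ {t₁ t₂ t₃ t₄ t₅ t₆ t₇} →
    t₁ ≤ k ℕ.* 20 ℕ.+ 8 → t₂ ≤ m ℕ.* 19 ℕ.+ 13 → t₃ ≤ n ℕ.* 36 ℕ.+ 4 → t₄ ≤ s ℕ.* 12 ℕ.+ 6 →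
    t₅ ≤ suc d ℕ.* 17 ℕ.+ 6 → t₆ ≤ n ℕ.* 42 ℕ.+ c ℕ.* (suc d ℕ.* 38 ℕ.+ 8) ℕ.+ 4 →
    t₇ ≤ d ℕ.* 20 ℕ.+ 6 →
    3 ℕ.+ (t₁ ℕ.+ (t₂ ℕ.+ (t₃ ℕ.+ (t₄ ℕ.+ (t₅ ℕ.+ (24 ℕ.+ (3 ℕ.+ (t₆ ℕ.+ (3 ℕ.+ (t₇ ℕ.+ 34)))))))))) ≤ w ℕ.* 381
  total-time t₁≤ t₂≤ t₃≤ t₄≤ t₅≤ t₆≤ t₇≤ =
    add 3 378 (constant 3) (
    add 28 350 (linear 20 8 t₁≤ k≤w) (
    add 32 318 (linear 19 13 t₂≤ (ℕₚ.≤-trans m≤n n≤w)) (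
    add 40 278 (linear 36 4 t₃≤ n≤w) (
    add 18 260 (linear 12 6 t₄≤ (ℕₚ.≤-trans s≤m (ℕₚ.≤-trans m≤n n≤w))) (
    -- The loop also visits the virtual axis, and 17 (d + 1) + 6 = 17 d + 23.
    add 40 220 (linear 17 23 (ℕₚ.≤-trans t₅≤ (ℕₚ.≤-reflexive
      (trans (cong (ℕ._+ 6) (ℕₚ.+-comm 17 (d ℕ.* 17))) (ℕₚ.+-assoc (d ℕ.* 17) 17 6)))) d≤w) (
    add 24 196 (constant 24) (
    add 3 193 (constant 3) (
    add 130 63 (ℕₚ.≤-trans t₆≤ encoding-time) (
    add 3 60 (constant 3) (
    add 26 34 (linear 20 6 t₇≤ d≤w) (constant 34)))))))))))

-- From integer bounds to the real logarithm

module FinalBounds (R : Reals) {d k : ℕ} (2≤d : 2 ≤ d) (2^k≤d : 2 ℕ.^ k ≤ d) (d<2^1+k : d ℕ.< 2 ℕ.^ suc k) where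
  open Reals R
    using (ℝ; _+_; _*_; _⁻¹; 0#; 1#; _<_; fromℕ; log₂; *-pos)
    renaming (_≤_ to _≤ᵣ_; _/_ to _/ᵣ_)
  open Geometry R using (volume)
  open OrderedFieldProperties (Reals.orderedField R) hiding (≤-trans)
  open RealsProperties R
  open ≤-Reasoning

  1≤k : 1 ℕ.≤ k
  1≤k = ℕₚ.≮⇒≥ λ k<1 → ℕₚ.<⇒≱ d<2^1+k
    (subst (λ k → 2 ℕ.^ suc k ℕ.≤ d) (sym (ℕₚ.n<1⇒n≡0 k<1)) 2≤d)

  k≤L : fromℕ k ≤ᵣ log₂ d
  k≤L = log₂-≥ d k (suc k) 2^k≤d d<2^1+k

  L≤1+k : log₂ d ≤ᵣ fromℕ (suc k)
  L≤1+k = log₂-≤ d (suc k) (ℕₚ.≤-trans (ℕ.s≤s ℕ.z≤n) 2≤d) d<2^1+k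

  0<L : 0# < log₂ d
  0<L = <-≤-trans 0<k k≤L
    where
    0<k : 0# < fromℕ k
    0<k = <-≤-trans (0<fromℕ 0) (fromℕ-mono-≤ 1≤k)

  timeAtMost : ∀ {C n t} → t ℕ.≤ (n ℕ.+ d ℕ.* k) ℕ.* C → TimeAtMost R C n d t
  timeAtMost {C} {n} {t} t≤ = begin
    fromℕ t                                     ≤⟨ fromℕ-mono-≤ t≤ ⟩
    fromℕ ((n ℕ.+ d ℕ.* k) ℕ.* C)               ≡⟨ cong fromℕ (ℕₚ.*-comm (n ℕ.+ d ℕ.* k) C) ⟩
    fromℕ (C ℕ.* (n ℕ.+ d ℕ.* k))               ≡⟨ fromℕ-* C _ ⟩
    fromℕ C * fromℕ (n ℕ.+ d ℕ.* k)             ≡⟨ cong (fromℕ C *_) (trans (fromℕ-+ n _) (cong (fromℕ n +_) (fromℕ-* d k))) ⟩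
    fromℕ C * (fromℕ n + fromℕ d * fromℕ k)     ≤⟨ *-monoʳ-≤ (0≤fromℕ C) (+-monoʳ-≤ (fromℕ n) (*-monoʳ-≤ (0≤fromℕ d) k≤L)) ⟩
    fromℕ C * (fromℕ n + fromℕ d * log₂ d)      ∎

  -- The crux is L (m + 1) ≤ m (k + 1) + L ≤ n + L. Only one of the m + 1 slabs is charged to L, so
  -- rounding L up to k + 1 costs nothing in the denominator.
  volumeAtLeast : ∀ {n m} (B : Box R d) → m ℕ.* suc k ℕ.≤ n →
    ½ * (½ * fromℕ (suc m) ⁻¹) ≤ᵣ volume B → VolumeAtLeast R n B
  volumeAtLeast {n} {m} B m*k≤n v≥ = y≤x*z⇒y/x≤z (*-pos (0<fromℕ 3) 0<n+L) (begin
    L                                   ≡⟨ x*[y/x]≡y (0<fromℕ m) L ⟨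
    M * (L * c)                         ≡⟨ solve 3 (λ M L c → M :* (L :* c) := (L :* M) :* c) refl M L c ⟩
    (L * M) * c                         ≤⟨ *-monoˡ-≤ (inj₁ (0<x⇒0<x⁻¹ (0<fromℕ m))) L*M≤n+L ⟩
    (fromℕ n + L) * c                   ≡⟨ solve 2 (λ x c → x :* c := (con 1 :* con 1 :* x) :* c) refl (fromℕ n + L) c ⟩
    -- Each 1 becomes 2 * ½, a relation unknown to the solver, to produce the factors 4 and ½ * ½.
    1# * 1# * (fromℕ n + L) * c         ≡⟨ cong (λ u → u * u * (fromℕ n + L) * c) (sym 2*½≡1) ⟩
    (fromℕ 2 * ½) * (fromℕ 2 * ½) * (fromℕ n + L) * c
      ≡⟨ solve 4 (λ t h x c → (t :* h) :* (t :* h) :* x :* c := (t :* t) :* x :* (h :* (h :* c))) refl (fromℕ 2) ½ (fromℕ n + L) c ⟩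
    (fromℕ 2 * fromℕ 2) * (fromℕ n + L) * (½ * (½ * c))
      ≡⟨ cong (λ f → f * (fromℕ n + L) * (½ * (½ * c))) (fromℕ-* 2 2) ⟨
    fromℕ 4 * (fromℕ n + L) * (½ * (½ * c))
      ≤⟨ *-monoʳ-≤ (inj₁ (*-pos (0<fromℕ 3) 0<n+L)) v≥ ⟩
    fromℕ 4 * (fromℕ n + L) * volume B  ∎)
    where
    open SemiringSolver commutativeSemiring using (solve; _:=_; _:+_; _:*_; con)
    L M c : ℝ
    L = log₂ d
    M = fromℕ (suc m)
    c = M ⁻¹
    2*½≡1 : fromℕ 2 * ½ ≡ 1#
    2*½≡1 = OrderedField.⁻¹-inverse (Reals.orderedField R) (fromℕ 2) (>⇒≢ (0<fromℕ 1))
    0<n+L : 0# < fromℕ n + L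
    0<n+L = ≤-<-trans (0≤fromℕ n) (subst (_< fromℕ n + L) (+-identityʳ (fromℕ n)) (+-monoʳ-< (fromℕ n) 0<L))
    L*M≤n+L : L * M ≤ᵣ fromℕ n + L
    L*M≤n+L = begin
      L * (1# + fromℕ m)              ≡⟨ solve 2 (λ L m → L :* (con 1 :+ m) := m :* L :+ L) refl L (fromℕ m) ⟩
      fromℕ m * L + L                 ≤⟨ +-monoˡ-≤ L (*-monoʳ-≤ (0≤fromℕ m) L≤1+k) ⟩
      fromℕ m * fromℕ (suc k) + L     ≡⟨ cong (_+ L) (fromℕ-* m (suc k)) ⟨
      fromℕ (m ℕ.* suc k) + L         ≤⟨ +-monoˡ-≤ L (fromℕ-mono-≤ m*k≤n) ⟩
      fromℕ n + L                     ∎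

-- Assembling the run of the whole program

module Correctness (R : Reals) {d n : ℕ} (2≤d : 2 ≤ d) (S : Fin n → Point R d) where
  open Reals R using (ℝ; fromℕ; _/_)
  open Execution R S hiding (Computes)
  open Hoare R S
  open Stages R S

  open OrderedFieldProperties (Reals.orderedField R) using (midpoint)

  σ₀ : Store
  σ₀ = update nat initial POWER 0 1

  restricted : Store → Store
  restricted σ = update nat (update real (update real σ
    LO 0 (fromℕ (σ nat SLAB 0) / fromℕ (suc (σ nat SLABS 0))))
    HI 0 (fromℕ (suc (σ nat SLAB 0)) / fromℕ (suc (σ nat SLABS 0))))
    PT 0 0

  module Output (σ : Store) {j : ℕ} (table≡ : σ nat TABLE (σ nat CODE (σ nat AXIS 0)) ≡ suc j)
                (j<i : j ℕ.< σ nat AXIS 0) where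
    private
      i partner : ℕ
      i = σ nat AXIS 0
      partner = σ nat TABLE (σ nat CODE i) ℕ.∸ 1

      σ₁ σ₂ : Store
      σ₁ = update nat σ PARTNER 0 partner
      σ₂ = update real σ₁ LO partner (midpoint (σ real LO partner) (σ real HI partner))

      partner≡j : partner ≡ j
      partner≡j = cong (ℕ._∸ 1) table≡

    final : Store
    final = update real σ₂ HI i (midpoint (σ₂ real LO i) (σ₂ real HI i))

    output-run : ⟨ output , σ ⟩⇓[ 34 ] final
    output-run = ⇓-seq ⇓-assign (⇓-seq ⇓-assign ⇓-assign)

    lo-j : final real LO j ≡ midpoint (σ real LO j) (σ real HI j)
    lo-j = subst (λ p → set (σ real) LO p (midpoint (σ real LO p) (σ real HI p)) LO j ≡ midpoint (σ real LO j) (σ real HI j))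
      (sym partner≡j) (set-≡ (σ real) LO j _)

    lo-other : ∀ {x} → j ≢ x → final real LO x ≡ σ real LO x
    lo-other j≢x = set-≢ (σ real) LO _ (j≢x ∘ trans (sym partner≡j))

    -- The second midpoint is computed after the first write; as j < i, that write has left the
    -- lower end along i alone.
    hi-i : final real HI i ≡ midpoint (σ real LO i) (σ real HI i)
    hi-i = trans (set-≡ (σ₂ real) HI i _)
      (cong (λ l → midpoint l (σ real HI i)) (lo-other (ℕₚ.<⇒≢ j<i)))

    hi-other : ∀ {x} → i ≢ x → final real HI x ≡ σ real HI x
    hi-other i≢x = set-≢ (σ₂ real) HI _ i≢x

  correct : Σ[ B ∈ Box R d ] ∃[ t ] Computes R S program B t × TimeAtMost R 381 n d t ×
            IsEmptyBox R S B × VolumeAtLeast R n B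
  correct
    with halts {t₁} {σ₁} r₁ (2^k≤d , d<2^1+k , t₁≤)
      ← computeLevels-halts σ₀ (ℕₚ.<⇒≤ 2≤d) refl refl
    with halts {t₂} {σ₂} r₂ (m*k≤n , n<m*k , t₂≤)
      ← computeSlabs-halts σ₁ refl (frame nat SLABS refl r₁ 0)
    with halts {t₃} {σ₃} r₃ (count≡ , t₃≤)
      ← countPoints-halts σ₂ refl
          -- Arrays not yet written are still cleared: `frame` leads back across all earlier loops
          -- to `σ₀`, where the value 0 holds by computation.
          (frame nat PT refl (⇓-seq r₁ r₂) 0)
          (frame nat COUNT refl (⇓-seq r₁ r₂))
    with halts {t₄} {σ₄} r₄ (s≤m , count≤k , t₄≤)
      ← findSlab-halts σ₃
          (frame nat LEVELS refl (⇓-seq r₂ r₃) 0)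
          (frame nat SLAB refl (⇓-seq r₁ (⇓-seq r₂ r₃)) 0)
          count≡ n<m*k
    with halts {t₅} {σ₅} r₅ (hi≡1 , t₅≤)
      ← unitBox-halts σ₄ (frame nat AXIS refl (⇓-seq r₁ (⇓-seq r₂ (⇓-seq r₃ r₄))) 0)
    with r₁₋₅ ← ⇓-seq r₁ (⇓-seq r₂ (⇓-seq r₃ (⇓-seq r₄ r₅)))
    with m≡ ← frame nat SLABS refl (⇓-seq r₃ (⇓-seq r₄ r₅)) 0
    with s≡ ← frame nat SLAB refl r₅ 0
    with halts {t₆} {σ₆} r₆ (code≡ , t₆≤)
      ← encodePoints-halts (restricted σ₅) m≡ s≡ refl (frame nat CODE refl r₁₋₅)
    with halts {t₇} {σ₇} r₇ (j , table≡ , i≤d , j<i , fj≡fi , t₇≤)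
      ← findCollision-halts (update nat σ₆ AXIS 0 0) refl
          (λ v → trans (frame nat TABLE refl r₆ v) (frame nat TABLE refl r₁₋₅ v))
          (λ x x≤d → subst (ℕ._< d) (sym (code≡ x x≤d))
            (ℕₚ.<-≤-trans (Coding.code-< _ _ _ n) (ℕₚ.≤-trans (ℕₚ.^-monoʳ-≤ 2 count≤k) 2^k≤d)))
    = box , _ ,
      ( final
      , ⇓-seq ⇓-assign (⇓-seq r₁ (⇓-seq r₂ (⇓-seq r₃ (⇓-seq r₄ (⇓-seq r₅
          (⇓-seq (⇓-seq ⇓-assign ⇓-assign) (⇓-seq ⇓-assign (⇓-seq r₆
          (⇓-seq ⇓-assign (⇓-seq r₇ output-run))))))))))
      , λ _ → refl , refl ) ,
      timeAtMost {381} {n} (total-time {m = m} (ℕₚ.<⇒≤ 2≤d) 1≤k (ℕₚ.≤-trans (ℕₚ.m≤m*n m (suc k)) m*k≤n) s≤m count≤k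
        t₁≤ t₂≤ t₃≤ t₄≤ t₅≤ t₆≤ t₇≤) ,
      record { inCube = box-inCube ; empty = box-empty code-j≡code-i (ℕₚ.<⇒≤ 2≤d) } ,
      volumeAtLeast {m = m} box m*k≤n volume-≥
    where
    k m s i : ℕ
    k = σ₁ nat LEVELS 0
    m = σ₂ nat SLABS 0
    s = σ₄ nat SLAB 0
    i = σ₇ nat AXIS 0
    lo hi : ℕ → ℝ
    lo = restricted σ₅ real LO
    hi = restricted σ₅ real HI
    lo≡ : ∀ x → σ₇ real LO x ≡ lo x
    lo≡ x = trans (frame real LO refl r₇ x) (frame real LO refl r₆ x)
    hi≡ : ∀ x → σ₇ real HI x ≡ hi x
    hi≡ x = trans (frame real HI refl r₇ x) (frame real HI refl r₆ x)
    open Output σ₇ (trans (cong (σ₇ nat TABLE) (frame nat CODE refl r₇ i)) table≡) j<i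
    open SlabBox R S
    open FinalBounds R {k = k} 2≤d 2^k≤d d<2^1+k
    open InSlab {m} {s} s≤m {lo} {hi}
      (cong₂ (λ s m → fromℕ s / fromℕ (suc m)) s≡ m≡)
      (λ x → frame real LO refl r₁₋₅ (suc x))
      (cong₂ (λ s m → fromℕ (suc s) / fromℕ (suc m)) s≡ m≡)
      (λ x x<d → hi≡1 (suc x) x<d)
    open Halved {i} {j} i≤d j<i {final real LO} {final real HI}
      (trans lo-j (cong₂ midpoint (lo≡ j) (hi≡ j)))
      (λ {x} j≢x → trans (lo-other j≢x) (lo≡ x))
      (trans hi-i (cong₂ midpoint (lo≡ i) (hi≡ i)))
      (λ {x} i≢x → trans (hi-other i≢x) (hi≡ x))
    code-j≡code-i : Coding.code (bucket m) s (bit lo hi j) n ≡ Coding.code (bucket m) s (bit lo hi i) n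
    code-j≡code-i = trans (sym (code≡ j (ℕₚ.<⇒≤ (ℕₚ.<-≤-trans j<i i≤d)))) (trans fj≡fi (code≡ i i≤d))

theorem1 : Σ[ prog ∈ Program ] Σ[ C ∈ ℕ ]
    ((R : Reals) (d n : ℕ) → 2 ≤ d →
    (S : Fin n → Point R d) → IsPointSet R S →
    Σ[ B ∈ Box R d ] ∃[ t ]
    Computes R S prog B t × TimeAtMost R C n d t ×
    IsEmptyBox R S B × VolumeAtLeast R n B)
theorem1 = program , 381 , λ R d n 2≤d S _ → Correctness.correct R 2≤d S
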